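{- Let $\mathcal{H}$ be a connected $r$-uniform hypergraph on $n$ vertices whose longest Berge path has length $k$, where $k>r\ge3$. Then there is a good set $S$ of $\mathcal{H}$ such that either $|S|<n$ or $n=k+1$. In particular $\mathcal{S}_r(\mathcal{H})\ne\emptyset$.
   Context: Hypergraphs are simple. A Berge path of length $k$ is an alternating sequence $v_0e_1v_1\cdots v_{k-1}e_kv_k$ of distinct vertices and distinct edges with $v_{i-1},v_i\in e_i$. Connected means every two distinct vertices are joined by a Berge path. $p_{\mathcal{H}}(e)$ is the maximum length of a Berge path having $e$ as a defining edge. For $S\subseteq V(\mathcal{H})$, $N(S)=\{e\in E(\mathcal{H}):e\cap S\neq\emptyset\}$. For real $x\ge1$, $f_r(x)=\frac1r$ if $x=1$, $\frac{x}{r+1}$ if $1<x\le r-1$, $\frac1r\binom{x}{r-1}$ if $x\ge r$. If the longest Berge path of $\mathcal{H}$ has length $k$, a good set is a nonempty $S\subseteq V(\mathcal{H})$ with $p_{\mathcal{H}}(e)=k$ for all $e\in N(S)$ and $|N(S)|\le f_r(k)|S|$; $\mathcal{S}_r(\mathcal{H})$ is the family of all good sets. -}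

module Defs where

open import Data.Nat using (ℕ; zero; suc; _≤ᵇ_) renaming (_≤_ to _≤ℕ_)
open import Data.Nat.Combinatorics using (_C_)
open import Data.Bool using (Bool; true; false; _∧_; _∨_; if_then_else_)
open import Data.Fin using (Fin; inject₁; fromℕ) renaming (zero to fzero; suc to fsuc)
open import Data.Fin.Subset using (Subset; _∈_; ∣_∣; Nonempty)
open import Data.Vec using (Vec; []; _∷_; tabulate)
open import Data.Integer using (+_)
open import Data.Rational using (ℚ; _/_; _≤_; _*_)
open import Data.Product using (Σ; ∃; _×_; _,_)
open import Relation.Binary.PropositionalEquality using (_≡_; _≢_)
open import Function.Definitions using (Injective)

record Hypergraph (n : ℕ) : Set where
  field
    m      : ℕ
    edge   : Fin m → Subset n
    simple : Injective _≡_ _≡_ edge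
open Hypergraph public

Uniform : ∀ {n} → ℕ → Hypergraph n → Set
Uniform r H = ∀ i → ∣ edge H i ∣ ≡ r

record BergePath {n : ℕ} (H : Hypergraph n) (k : ℕ) : Set where
  field
    vert     : Fin (suc k) → Fin n
    edg      : Fin k → Fin (m H)
    vert-inj : Injective _≡_ _≡_ vert
    edg-inj  : Injective _≡_ _≡_ edg
    incid₀   : ∀ i → vert (inject₁ i) ∈ edge H (edg i)
    incid₁   : ∀ i → vert (fsuc i) ∈ edge H (edg i)
open BergePath public

Connected : ∀ {n} → Hypergraph n → Set
Connected {n} H = ∀ (u w : Fin n) → u ≢ w →
  Σ ℕ λ k → Σ (BergePath H k) λ P → (vert P fzero ≡ u) × (vert P (fromℕ k) ≡ w)

LongestPathLength : ∀ {n} → Hypergraph n → ℕ → Set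
LongestPathLength H k = BergePath H k × (∀ ℓ → BergePath H ℓ → ℓ ≤ℕ k)

Uses : ∀ {n} {H : Hypergraph n} {ℓ} → BergePath H ℓ → Fin (m H) → Set
Uses P e = ∃ λ i → edg P i ≡ e

PathNumber : ∀ {n} (H : Hypergraph n) → Fin (m H) → ℕ → Set
PathNumber H e ℓ =
  (Σ (BergePath H ℓ) λ P → Uses P e) ×
  (∀ ℓ' (P : BergePath H ℓ') → Uses P e → ℓ' ≤ℕ ℓ)

meets : ∀ {n} → Subset n → Subset n → Bool
meets []       []       = false
meets (a ∷ p)  (b ∷ q)  = (a ∧ b) ∨ meets p q

Nbhd : ∀ {n} (H : Hypergraph n) → Subset n → Subset (m H)
Nbhd H S = tabulate (λ i → meets (edge H i) S)

-- f_r(x) for natural x ≥ 1 (values for r = 0 or x = 0 are junk, unused).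
fr : ℕ → ℕ → ℚ
fr zero       x = + 0 / 1
fr (suc r') 1   = + 1 / suc r'
fr (suc r') x   =
  if x ≤ᵇ r'
  then + x / suc (suc r')
  else + (x C r') / suc r'

ℕtoℚ : ℕ → ℚ
ℕtoℚ a = + a / 1

-- S is a good set of H (with r, and k the length of a longest Berge path).
GoodSet : ∀ {n} (H : Hypergraph n) (r k : ℕ) → Subset n → Set
GoodSet H r k S =
  Nonempty S ×
  (∀ e → e ∈ Nbhd H S → PathNumber H e k) ×
  (ℕtoℚ ∣ Nbhd H S ∣ ≤ fr r k * ℕtoℚ ∣ S ∣)

{-# OPTIONS --safe #-}
module Submission where

-- Call the longest paths' ends simply ends. Every edge at an end lies on a longest path (rotate), so
-- only the number of edges meeting S has to be controlled, for S a set of ends.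
--
-- If some longest path closes up to a Berge cycle on its k + 1 vertices, then by connectedness the cycle spans H,
-- all vertices are ends, and S = V works because there are at most C(k + 1, r) edges.
--
-- Otherwise let P be a longest path from u to w. An edge off P meeting u lies inside P. The predecessors on P of the
-- off-path neighbours of u are not off-path neighbours of w, since rotating would give a cycle; hence u and w have
-- together at most k off-path neighbours. A path edge containing u lets u be rotated away without changing w or the
-- set of path edges. So one can choose P such that each of the a ends obtained by such rotations has at most k/2
-- off-path neighbours, hence at most B = C(⌊k/2⌋, r - 1) off-path edges. Taking S = {u} one meets at most a + B edges,
-- and taking S to be all a rotated ends at most k + a B; one of the two is small enough unless (r , k) = (3 , 4).

open import Defs
open import Data.Bool using (true; false; T; if_then_else_)
open import Data.Empty using (⊥-elim)
open import Data.Fin using (Fin; zero; suc; inject₁; fromℕ)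
import Data.Fin.Properties as Fin
open import Data.Fin.Subset using (Subset; inside; outside; ⊤; ⊥; ⁅_⁆; _∪_; _-_; ∣_∣) renaming (_∈_ to _∈ˢ_; _∉_ to _∉ˢ_; _⊆_ to _⊆ˢ_)
import Data.Fin.Subset.Properties as Sub
import Data.Integer as ℤ
import Data.Integer.Properties as ℤₚ
open import Data.List using (List; []; _∷_; _++_; length; map; foldr; filter; concatMap; tabulate; lookup; allFin)
open import Data.List.Membership.DecPropositional using (_∈?_)
open import Data.List.Membership.Propositional using (_∈_; _∉_; find; lose)
open import Data.List.Membership.Propositional.Properties
open import Data.List.Properties using (length-++; length-map; length-tabulate; length-filter; map-∘)
open import Data.List.Relation.Binary.Permutation.Propositional hiding (trans)
open import Data.List.Relation.Binary.Permutation.Propositional.Properties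
  using (↭-length; ∈-resp-↭; ++⁺ʳ; ++-comm; shift; ∷↭∷ʳ)
import Data.List.Relation.Binary.Permutation.Setoid.Properties as SetoidPermutation
open import Data.List.Relation.Unary.All using ([]; _∷_; all?)
import Data.List.Relation.Unary.All as All
import Data.List.Relation.Unary.All.Properties as All
open import Data.List.Relation.Unary.AllPairs using ([]; _∷_)
import Data.List.Relation.Unary.AllPairs.Properties as AllPairs
open import Data.List.Relation.Unary.Any using (Any; here; there; index; any?)
import Data.List.Relation.Unary.Any.Properties as Any
open import Data.List.Relation.Unary.Unique.Propositional using (Unique)
import Data.List.Relation.Unary.Unique.Propositional.Properties as Unique
open import Data.Nat hiding (∣_-_∣)
open import Data.Nat.Combinatorics using (_C_; nCk+nC[k+1]≡[n+1]C[k+1]; nCk≡nC[n∸k]; nCn≡1; nC1≡n; k>n⇒nCk≡0)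
open import Data.Nat.Properties
open import Data.Nat.Tactic.RingSolver using (solve-∀)
open import Data.Product using (Σ; ∃; ∃₂; _×_; _,_; proj₁; proj₂)
import Data.Rational as ℚ
import Data.Rational.Properties as ℚₚ
import Data.Rational.Unnormalised as ℚᵘ
import Data.Rational.Unnormalised.Properties as ℚᵘₚ
open import Data.Sum using (_⊎_; inj₁; inj₂)
open import Data.Vec using ([]; _∷_; here; there)
import Data.Vec.Properties as Vec
open import Function using (_∘_)
open import Function.Definitions using (Injective)
open import Relation.Binary.PropositionalEquality hiding ([_])
open import Relation.Nullary using (¬_; Dec; yes; no; contradiction; ¬?; _×-dec_)
open import Relation.Unary using (Pred; Decidable)

-- Binomial coefficients
pascal : ∀ n k → suc n C suc k ≡ n C k + n C suc k
pascal n k = sym (nCk+nC[k+1]≡[n+1]C[k+1] n k)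

nC0≡1 : ∀ n → n C 0 ≡ 1
nC0≡1 n = trans (nCk≡nC[n∸k] {0} {n} z≤n) (nCn≡1 n)

C-suc-≤ : ∀ n k → n C k ≤ suc n C k
C-suc-≤ n zero    = ≤-reflexive (trans (nC0≡1 n) (sym (nC0≡1 (suc n))))
C-suc-≤ n (suc k) = subst (n C suc k ≤_) (sym (pascal n k)) (m≤n+m (n C suc k) (n C k))

C-monoˡ-≤ : ∀ {m n} k → m ≤ n → m C k ≤ n C k
C-monoˡ-≤ {m} k m≤n = go (≤⇒≤′ m≤n)
  where
  go : ∀ {n} → m ≤′ n → m C k ≤ n C k
  go ≤′-refl           = ≤-refl
  go (≤′-step {n} m≤n) = ≤-trans (go m≤n) (C-suc-≤ n k)

-- This is what makes S = V good when a cycle spans: r times the C(k + 1, r) possible edges is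
-- exactly C(k, r - 1) times the k + 1 vertices. After Pascal's rule the induction is used at both
-- lower indices.
C-absorb : ∀ n k → suc k * (suc n C suc k) ≡ suc n * (n C k)
C-absorb zero    zero    = refl
C-absorb zero    (suc k) = begin
  suc (suc k) * (1 C suc (suc k)) ≡⟨ cong (suc (suc k) *_) (k>n⇒nCk≡0 {1} {2 + k} (s≤s (s≤s z≤n))) ⟩
  suc (suc k) * 0                 ≡⟨ *-zeroʳ (suc (suc k)) ⟩
  1 * 0                           ≡⟨ cong (1 *_) (k>n⇒nCk≡0 {0} {suc k} (s≤s z≤n)) ⟨
  1 * (0 C suc k)                 ∎
  where open ≡-Reasoning
C-absorb (suc n) zero    = begin
  1 * (suc (suc n) C 1)     ≡⟨ *-identityˡ _ ⟩
  suc (suc n) C 1           ≡⟨ nC1≡n (suc (suc n)) ⟩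
  suc (suc n)               ≡⟨ *-identityʳ _ ⟨
  suc (suc n) * 1           ≡⟨ cong (suc (suc n) *_) (nC0≡1 (suc n)) ⟨
  suc (suc n) * (suc n C 0) ∎
  where open ≡-Reasoning
C-absorb (suc n) (suc k) = begin
  suc (suc k) * (suc (suc n) C suc (suc k))
    ≡⟨ cong (suc (suc k) *_) (pascal (suc n) (suc k)) ⟩
  suc (suc k) * (x + suc n C suc (suc k))
    ≡⟨ *-distribˡ-+ (suc (suc k)) x (suc n C suc (suc k)) ⟩
  x + suc k * x + suc (suc k) * (suc n C suc (suc k))
    ≡⟨ cong₂ (λ a b → x + a + b) (C-absorb n k) (C-absorb n (suc k)) ⟩
  x + suc n * (n C k) + suc n * (n C suc k)
    ≡⟨ +-assoc x _ _ ⟩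
  x + (suc n * (n C k) + suc n * (n C suc k))
    ≡⟨ cong (x +_) (*-distribˡ-+ (suc n) (n C k) (n C suc k)) ⟨
  x + suc n * (n C k + n C suc k)
    ≡⟨ cong (λ a → x + suc n * a) (pascal n k) ⟨
  suc (suc n) * x ∎
  where
  open ≡-Reasoning
  x = suc n C suc k

-- Inductions that involve a half raise the upper index by two, so that the half grows by one; this
-- is the matching expansion.
pascal² : ∀ n k → suc (suc n) C suc (suc k) ≡ n C k + 2 * (n C suc k) + n C suc (suc k)
pascal² n k = begin
  suc (suc n) C suc (suc k)                           ≡⟨ pascal (suc n) (suc k) ⟩
  suc n C suc k + suc n C suc (suc k)                 ≡⟨ cong₂ _+_ (pascal n k) (pascal n (suc k)) ⟩
  n C k + n C suc k + (n C suc k + n C suc (suc k))   ≡⟨ lemma (n C k) (n C suc k) _ ⟩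
  n C k + 2 * (n C suc k) + n C suc (suc k)           ∎
  where
  open ≡-Reasoning
  lemma : ∀ a b c → a + b + (b + c) ≡ a + 2 * b + c
  lemma = solve-∀

-- Group 2h points into h pairs: k pairs and one point of each give 2^k C(h, k) different k-sets.
-- The induction adds one pair at a time and drops the sets that contain both of its points.
2^k*hCk≤2hCk : ∀ h k → 2 ^ k * (h C k) ≤ (h + h) C k
2^k*hCk≤2hCk h zero = ≤-reflexive (trans (*-identityˡ (h C 0)) (trans (nC0≡1 h) (sym (nC0≡1 (h + h)))))
2^k*hCk≤2hCk zero (suc k) = ≤-trans (≤-reflexive (trans (cong (2 ^ suc k *_) (k>n⇒nCk≡0 {0} {suc k} (s≤s z≤n))) (*-zeroʳ (2 ^ suc k)))) z≤n
2^k*hCk≤2hCk (suc h) (suc zero) = ≤-reflexive (begin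
  2 * (suc h C 1)       ≡⟨ cong (2 *_) (nC1≡n (suc h)) ⟩
  2 * suc h             ≡⟨ cong (suc h +_) (+-identityʳ (suc h)) ⟩
  suc h + suc h         ≡⟨ nC1≡n (suc h + suc h) ⟨
  (suc h + suc h) C 1   ∎)
  where open ≡-Reasoning
2^k*hCk≤2hCk (suc h) (suc (suc k)) = begin
  2 ^ suc (suc k) * (suc h C suc (suc k))
    ≡⟨ cong (2 ^ suc (suc k) *_) (pascal h (suc k)) ⟩
  2 * 2 ^ suc k * (h C suc k + h C suc (suc k))
    ≡⟨ lemma (2 ^ suc k) (h C suc k) (h C suc (suc k)) ⟩
  2 * (2 ^ suc k * (h C suc k)) + 2 ^ suc (suc k) * (h C suc (suc k))
    ≤⟨ +-mono-≤ (*-monoʳ-≤ 2 (2^k*hCk≤2hCk h (suc k))) (2^k*hCk≤2hCk h (suc (suc k))) ⟩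
  2 * ((h + h) C suc k) + (h + h) C suc (suc k)
    ≤⟨ +-monoˡ-≤ _ (m≤n+m _ ((h + h) C k)) ⟩
  (h + h) C k + 2 * ((h + h) C suc k) + (h + h) C suc (suc k)
    ≡⟨ pascal² (h + h) k ⟨
  suc (suc (h + h)) C suc (suc k)
    ≡⟨ cong (λ m → suc m C suc (suc k)) (+-suc h h) ⟨
  (suc h + suc h) C suc (suc k) ∎
  where
  open ≤-Reasoning
  lemma : ∀ p x y → 2 * p * (x + y) ≡ 2 * (p * x) + 2 * p * y
  lemma = solve-∀

n≤nCk : ∀ {n k} → 1 ≤ k → k < n → n ≤ n C k
n≤nCk {n} {suc zero} _ _ = ≤-reflexive (sym (nC1≡n n))
n≤nCk {suc n} {suc (suc k)} _ (s≤s k<n) = begin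
  suc n                         ≡⟨ +-comm 1 n ⟩
  n + 1                         ≡⟨ cong (n +_) (nCn≡1 (suc (suc k))) ⟨
  n + suc (suc k) C suc (suc k) ≤⟨ +-mono-≤ (n≤nCk (s≤s z≤n) k<n) (C-monoˡ-≤ (suc (suc k)) k<n) ⟩
  n C suc k + n C suc (suc k)   ≡⟨ pascal n (suc k) ⟨
  suc n C suc (suc k)           ∎
  where open ≤-Reasoning

⌊n/2⌋+⌊n/2⌋≤n : ∀ n → ⌊ n /2⌋ + ⌊ n /2⌋ ≤ n
⌊n/2⌋+⌊n/2⌋≤n n = ≤-trans (+-monoʳ-≤ ⌊ n /2⌋ (⌊n/2⌋≤⌈n/2⌉ n)) (≤-reflexive (⌊n/2⌋+⌈n/2⌉≡n n))

k<2^k : ∀ k → k < 2 ^ k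
k<2^k zero    = s≤s z≤n
k<2^k (suc k) = begin
  2 + k           ≤⟨ s≤s (k<2^k k) ⟩
  1 + 2 ^ k       ≤⟨ +-mono-≤ (>-nonZero⁻¹ (2 ^ k) {{m^n≢0 2 k}}) (m≤m+n (2 ^ k) 0) ⟩
  2 ^ k + (2 ^ k + 0) ∎
  where open ≤-Reasoning

-- Halving the number of vertices costs a factor 2^q in the binomial coefficient, which pays for the factor r = q + 1.
half-bound : ∀ p j → let q = 3 + p; k = j + (2 + q) in
  suc q * k + 2 * suc q * (⌊ k /2⌋ C q) ≤ 2 * (k C q)
-- For k = q + 2 half of k is below q, so its binomial coefficient vanishes, and C(q + 2, q) = C(q +
-- 2, 2) gives equality.
half-bound p zero = begin
  suc q * (2 + q) + 2 * suc q * (⌊ 2 + q /2⌋ C q)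
    ≡⟨ cong (λ c → suc q * (2 + q) + 2 * suc q * c) (k>n⇒nCk≡0 (s≤s (s≤s (⌊n/2⌋<n p)))) ⟩
  suc q * (2 + q) + 2 * suc q * 0
    ≡⟨ lemma q ⟩
  (2 + q) * suc q
    ≡⟨ cong ((2 + q) *_) (nC1≡n (suc q)) ⟨
  (2 + q) * (suc q C 1)
    ≡⟨ C-absorb (suc q) 1 ⟨
  2 * ((2 + q) C 2)
    ≡⟨ cong (λ m → 2 * ((2 + q) C m)) (m+n∸n≡m 2 q) ⟨
  2 * ((2 + q) C (2 + q ∸ q))
    ≡⟨ cong (2 *_) (nCk≡nC[n∸k] {q} {2 + q} (m≤n+m q 2)) ⟨
  2 * ((2 + q) C q) ∎
  where
  open ≤-Reasoning
  q = 3 + p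
  lemma : ∀ q → suc q * (2 + q) + 2 * suc q * 0 ≡ (2 + q) * suc q
  lemma = solve-∀
-- For q = 3 and k = 6 the half is 3 and C(3, 3) = 1 does not vanish; the sides are 24 + 8 and 2 *
-- 20.
half-bound zero (suc zero) = ≤ᵇ⇒≤ 32 40 _
-- From q = 4 on, half of q + 3 is below q again. The factor 3 lets C(q + 3, 3) be expanded by
-- absorption.
half-bound (suc p) (suc zero) = *-cancelˡ-≤ 3 (begin
  3 * (suc q * (3 + q) + 2 * suc q * (⌊ 3 + q /2⌋ C q))
    ≡⟨ cong (λ c → 3 * (suc q * (3 + q) + 2 * suc q * c)) (k>n⇒nCk≡0 (s≤s (s≤s (s≤s (⌊n/2⌋<n p))))) ⟩
  3 * (suc q * (3 + q) + 2 * suc q * 0)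
    ≡⟨ lemma q ⟩
  (3 + q) * (3 * suc q)
    ≤⟨ *-monoʳ-≤ (3 + q) (*-monoˡ-≤ (suc q) {3} {2 + q} (s≤s (s≤s (s≤s z≤n)))) ⟩
  (3 + q) * ((2 + q) * suc q)
    ≡⟨ cong (λ c → (3 + q) * ((2 + q) * c)) (nC1≡n (suc q)) ⟨
  (3 + q) * ((2 + q) * (suc q C 1))
    ≡⟨ cong ((3 + q) *_) (C-absorb (suc q) 1) ⟨
  (3 + q) * (2 * ((2 + q) C 2))
    ≡⟨ lemma₂ (3 + q) 2 ((2 + q) C 2) ⟩
  2 * ((3 + q) * ((2 + q) C 2))
    ≡⟨ cong (2 *_) (C-absorb (2 + q) 2) ⟨
  2 * (3 * ((3 + q) C 3))
    ≡⟨ cong (λ m → 2 * (3 * ((3 + q) C m))) (m+n∸n≡m 3 q) ⟨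
  2 * (3 * ((3 + q) C (3 + q ∸ q)))
    ≡⟨ cong (λ c → 2 * (3 * c)) (nCk≡nC[n∸k] {q} {3 + q} (m≤n+m q 3)) ⟨
  2 * (3 * ((3 + q) C q))
    ≡⟨ lemma₂ 2 3 ((3 + q) C q) ⟩
  3 * (2 * ((3 + q) C q)) ∎)
  where
  open ≤-Reasoning
  q = 4 + p
  lemma : ∀ q → 3 * (suc q * (3 + q) + 2 * suc q * 0) ≡ (3 + q) * (3 * suc q)
  lemma = solve-∀
  lemma₂ : ∀ a b c → a * (b * c) ≡ b * (a * c)
  lemma₂ = solve-∀
-- With r = q + 1, raising k by two adds 2r + 2rx on the left. The first two terms of `pascal²` pay
-- for this, 2r by `q<kC` and 2rx by `qx≤`.
half-bound p (suc (suc j)) = begin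
  suc q * (2 + k) + 2 * suc q * (suc ⌊ k /2⌋ C q)
    ≡⟨ cong (λ c → suc q * (2 + k) + 2 * suc q * c) (pascal ⌊ k /2⌋ (2 + p)) ⟩
  suc q * (2 + k) + 2 * suc q * (x + ⌊ k /2⌋ C q)
    ≡⟨ lemma (suc q) k x (⌊ k /2⌋ C q) ⟩
  2 * suc q + 2 * (suc q * x) + (suc q * k + 2 * suc q * (⌊ k /2⌋ C q))
    ≤⟨ +-mono-≤ (+-mono-≤ (*-monoʳ-≤ 2 q<kC) (*-monoʳ-≤ 2 qx≤)) (half-bound p j) ⟩
  2 * (k C (1 + p)) + 2 * (2 * (k C (2 + p))) + 2 * (k C q)
    ≡⟨ lemma₂ (k C (1 + p)) (k C (2 + p)) (k C q) ⟩
  2 * (k C (1 + p) + 2 * (k C (2 + p)) + k C q)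
    ≡⟨ cong (2 *_) (pascal² k (1 + p)) ⟨
  2 * ((2 + k) C q) ∎
  where
  open ≤-Reasoning
  q = 3 + p
  k = j + (2 + q)
  x = ⌊ k /2⌋ C (2 + p)
  lemma : ∀ r k x y → r * (2 + k) + 2 * r * (x + y) ≡ 2 * r + 2 * (r * x) + (r * k + 2 * r * y)
  lemma = solve-∀
  lemma₂ : ∀ a b c → 2 * a + 2 * (2 * b) + 2 * c ≡ 2 * (a + 2 * b + c)
  lemma₂ = solve-∀
  q<kC : suc q ≤ k C (1 + p)
  q<kC = ≤-trans (≤-trans (n≤1+n (suc q)) (m≤n+m (2 + q) j))
    (n≤nCk (s≤s z≤n) (≤-trans (m≤n+m (2 + p) 3) (m≤n+m (2 + q) j)))
  qx≤ : suc q * x ≤ 2 * (k C (2 + p))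
  qx≤ = begin
    suc q * x                                         ≤⟨ *-monoˡ-≤ x (k<2^k q) ⟩
    2 ^ q * x                                         ≡⟨ *-assoc 2 (2 ^ (2 + p)) x ⟩
    2 * (2 ^ (2 + p) * x)                             ≤⟨ *-monoʳ-≤ 2 (2^k*hCk≤2hCk ⌊ k /2⌋ (2 + p)) ⟩
    2 * ((⌊ k /2⌋ + ⌊ k /2⌋) C (2 + p))               ≤⟨ *-monoʳ-≤ 2 (C-monoˡ-≤ (2 + p) (⌊n/2⌋+⌊n/2⌋≤n k)) ⟩
    2 * (k C (2 + p))                                 ∎

-- For q = 2 the inequality of `half-bound` fails at k = 5, where 15 + 6 > 20. So k gets the
-- coefficient 1 in place of r/2 = 3/2, which is enough once a is at least 3.
half-bound-3 : ∀ j → let k = 5 + j in k + 3 * (⌊ k /2⌋ C 2) ≤ k C 2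
half-bound-3 zero          = ≤ᵇ⇒≤ 8 10 _
half-bound-3 (suc zero)    = ≤ᵇ⇒≤ 15 15 _
half-bound-3 (suc (suc j)) = begin
  2 + k + 3 * (suc h C 2)
    ≡⟨ cong (λ c → 2 + k + 3 * c) (trans (pascal h 1) (cong (_+ h C 2) (nC1≡n h))) ⟩
  2 + k + 3 * (h + h C 2)
    ≡⟨ lemma k h (h C 2) ⟩
  1 + (1 + h) + (h + h) + (k + 3 * (h C 2))
    ≤⟨ +-mono-≤ (+-mono-≤ (s≤s 1+h≤k) h+h≤k) (half-bound-3 j) ⟩
  1 + k + k + k C 2
    ≡⟨ cong (λ a → 1 + a + k C 2) (cong (k +_) (+-identityʳ k)) ⟨
  1 + 2 * k + k C 2
    ≡⟨ cong₂ (λ a b → a + 2 * b + k C 2) (nC0≡1 k) (nC1≡n k) ⟨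
  k C 0 + 2 * (k C 1) + k C 2
    ≡⟨ pascal² k 0 ⟨
  (2 + k) C 2 ∎
  where
  open ≤-Reasoning
  k = 5 + j
  h = ⌊ k /2⌋
  h+h≤k = ⌊n/2⌋+⌊n/2⌋≤n k
  1+h≤k : 1 + h ≤ k
  1+h≤k = ⌊n/2⌋<n (4 + j)
  lemma : ∀ k h c → 2 + k + 3 * (h + c) ≡ 1 + (1 + h) + (h + h) + (k + 3 * c)
  lemma = solve-∀

-- The two alternatives are the edge counts for S = {u} and for S the set of all a rotations.
count-bound : ∀ {q k} a → 2 ≤ q → suc q < k → ¬ (q ≡ 2 × k ≡ 4) → 1 ≤ a →
  let B = ⌊ k /2⌋ C q in
  suc q * (a + B) ≤ k C q ⊎ suc q * (k + a * B) ≤ (k C q) * a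
count-bound {q} a 2≤q q<k not-3-4 1≤a with m≤n⇒∃[o]m+o≡n q<k
count-bound {suc zero} _ (s≤s ()) _ _ _ | _
count-bound {suc (suc zero)} _ _ _ not-3-4 _ | zero , refl = contradiction (refl , refl) not-3-4
count-bound {suc (suc zero)} a 2≤q q<k not-3-4 1≤a | suc j , refl with a ≤? 2
... | yes a≤2 = inj₁ (≤-trans (*-monoʳ-≤ 3 (+-monoˡ-≤ _ a≤2)) (small j))
  where
  -- The summand 3 * 2 is at most k from k = 6 on; k = 5 is the check 9 ≤ 10.
  small : ∀ j → 3 * (2 + ⌊ 5 + j /2⌋ C 2) ≤ (5 + j) C 2
  small zero    = ≤ᵇ⇒≤ 9 10 _
  small (suc j) = begin
    3 * (2 + ⌊ 6 + j /2⌋ C 2)       ≡⟨ *-distribˡ-+ 3 2 (⌊ 6 + j /2⌋ C 2) ⟩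
    6 + 3 * (⌊ 6 + j /2⌋ C 2)       ≤⟨ +-monoˡ-≤ _ (m≤m+n 6 j) ⟩
    6 + j + 3 * (⌊ 6 + j /2⌋ C 2)   ≤⟨ half-bound-3 (suc j) ⟩
    (6 + j) C 2                     ∎
    where open ≤-Reasoning
... | no a≰2 = inj₂ (begin
    3 * (k + a * B)         ≡⟨ lemma k a B ⟩
    3 * k + a * (3 * B)     ≤⟨ +-monoˡ-≤ _ (*-monoˡ-≤ k (≰⇒> a≰2)) ⟩
    a * k + a * (3 * B)     ≡⟨ *-distribˡ-+ a k (3 * B) ⟨
    a * (k + 3 * B)         ≤⟨ *-monoʳ-≤ a (half-bound-3 j) ⟩
    a * (k C 2)             ≡⟨ *-comm a (k C 2) ⟩
    (k C 2) * a             ∎)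
  where
  open ≤-Reasoning
  k = 5 + j
  B = ⌊ k /2⌋ C 2
  lemma : ∀ k a b → 3 * (k + a * b) ≡ 3 * k + a * (3 * b)
  lemma = solve-∀
-- From q = 3 on, a single end is served by S = {u}; with more ends the factor a ≥ 2 absorbs the 2
-- left over from `half-bound`.
count-bound {suc (suc (suc p))} (suc zero) 2≤q q<k not-3-4 1≤a | j , refl =
  inj₁ (*-cancelˡ-≤ 2 (begin
    2 * (suc q * (1 + B))           ≡⟨ lemma (suc q) B ⟩
    suc q * 2 + 2 * suc q * B       ≤⟨ +-monoˡ-≤ _ (*-monoʳ-≤ (suc q) {2} {k} (s≤s (s≤s z≤n))) ⟩
    suc q * k + 2 * suc q * B       ≤⟨ bound ⟩
    2 * (k C q)                     ∎))
  where
  open ≤-Reasoning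
  q = 3 + p
  k = 2 + q + j
  B = ⌊ k /2⌋ C q
  bound : suc q * k + 2 * suc q * B ≤ 2 * (k C q)
  bound = subst (λ k → suc q * k + 2 * suc q * (⌊ k /2⌋ C q) ≤ 2 * (k C q)) (+-comm j (2 + q)) (half-bound p j)
  lemma : ∀ r b → 2 * (r * (1 + b)) ≡ r * 2 + 2 * r * b
  lemma = solve-∀
count-bound {suc (suc (suc p))} a@(suc (suc _)) 2≤q q<k not-3-4 1≤a | j , refl =
  inj₂ (*-cancelˡ-≤ 2 (begin
    2 * (suc q * (k + a * B))               ≡⟨ lemma (suc q) k a B ⟩
    2 * (suc q * k) + a * (2 * suc q * B)   ≤⟨ +-monoˡ-≤ _ (*-monoˡ-≤ (suc q * k) {2} {a} (s≤s (s≤s z≤n))) ⟩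
    a * (suc q * k) + a * (2 * suc q * B)   ≡⟨ *-distribˡ-+ a (suc q * k) (2 * suc q * B) ⟨
    a * (suc q * k + 2 * suc q * B)         ≤⟨ *-monoʳ-≤ a bound ⟩
    a * (2 * (k C q))                       ≡⟨ lemma₂ a (k C q) ⟩
    2 * ((k C q) * a)                       ∎))
  where
  open ≤-Reasoning
  q = 3 + p
  k = 2 + q + j
  B = ⌊ k /2⌋ C q
  bound : suc q * k + 2 * suc q * B ≤ 2 * (k C q)
  bound = subst (λ k → suc q * k + 2 * suc q * (⌊ k /2⌋ C q) ≤ 2 * (k C q)) (+-comm j (2 + q)) (half-bound p j)
  lemma : ∀ r k a b → 2 * (r * (k + a * b)) ≡ 2 * (r * k) + a * (2 * r * b)
  lemma = solve-∀
  lemma₂ : ∀ a c → a * (2 * c) ≡ 2 * (c * a)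
  lemma₂ = solve-∀

-- Lists, finite subsets and ratios

-- Injectivity is asked on members only, because deleting v is injective just among the edges that
-- contain v.
map-unique : ∀ {a b} {A : Set a} {B : Set b} (f : A → B) {xs} → Unique xs →
  (∀ {x y} → x ∈ xs → y ∈ xs → f x ≡ f y → x ≡ y) → Unique (map f xs)
map-unique f []                   _   = []
map-unique f {x ∷ xs} (x∉ ∷ uniq) inj =
  All.map⁺ (All.tabulate λ y∈ eq → All.lookup x∉ y∈ (inj (here refl) (there y∈) eq))
  ∷ map-unique f uniq (λ x∈ y∈ → inj (there x∈) (there y∈))

∉-tail : ∀ {a} {A : Set a} {x : A} {xs} → Unique (x ∷ xs) → x ∉ xs
∉-tail (x∉ ∷ _) x∈ = All.lookup x∉ x∈ refl

unique-tail : ∀ {a} {A : Set a} {x : A} {xs} → Unique (x ∷ xs) → Unique xs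
unique-tail (_ ∷ uniq) = uniq

unique-∷ : ∀ {a} {A : Set a} {x : A} {xs} → x ∉ xs → Unique xs → Unique (x ∷ xs)
unique-∷ x∉ uniq = All.¬Any⇒All¬ _ x∉ ∷ uniq

-- One occurrence of x is cut out of `ys`; by distinctness the other elements still lie in what
-- remains.
length-⊆ : ∀ {a} {A : Set a} {xs ys : List A} → Unique xs → (∀ {x} → x ∈ xs → x ∈ ys) → length xs ≤ length ys
length-⊆ {xs = []}     _          _     = z≤n
length-⊆ {xs = x ∷ xs} {ys} (x∉ ∷ u) xs⊆ys with ∈-∃++ (xs⊆ys (here refl))
... | as , bs , refl = begin
  suc (length xs)           ≤⟨ s≤s (length-⊆ u sub) ⟩
  suc (length (as ++ bs))   ≡⟨ cong suc (length-++ as) ⟩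
  suc (length as + length bs) ≡⟨ +-suc (length as) (length bs) ⟨
  length as + length (x ∷ bs) ≡⟨ length-++ as ⟨
  length (as ++ x ∷ bs)     ∎
  where
  open ≤-Reasoning
  sub : ∀ {y} → y ∈ xs → y ∈ as ++ bs
  sub y∈xs with ∈-++⁻ as (xs⊆ys (there y∈xs))
  ... | inj₁ y∈as         = ∈-++⁺ˡ y∈as
  ... | inj₂ (here refl)  = contradiction refl (All.lookup x∉ y∈xs)
  ... | inj₂ (there y∈bs) = ∈-++⁺ʳ as y∈bs

length-filter-disjoint : ∀ {a p q} {A : Set a} {P : Pred A p} {Q : Pred A q} (P? : Decidable P) (Q? : Decidable Q) (xs : List A) →
  (∀ {x} → x ∈ xs → P x → ¬ Q x) → length (filter P? xs) + length (filter Q? xs) ≤ length xs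
length-filter-disjoint P? Q? []       _        = z≤n
length-filter-disjoint P? Q? (x ∷ xs) disjoint with P? x | Q? x | length-filter-disjoint P? Q? xs (disjoint ∘ there)
... | yes p | yes q | _  = contradiction q (disjoint (here refl) p)
... | yes p | no _  | ih = s≤s ih
... | no _  | yes q | ih = ≤-trans (≤-reflexive (+-suc (length (filter P? xs)) _)) (s≤s ih)
... | no _  | no _  | ih = m≤n⇒m≤1+n ih

length-concatMap-≤ : ∀ {a b} {A : Set a} {B : Set b} (f : A → List B) c (xs : List A) →
  (∀ {x} → x ∈ xs → length (f x) ≤ c) → length (concatMap f xs) ≤ length xs * c
length-concatMap-≤ f c []       _ = z≤n
length-concatMap-≤ f c (x ∷ xs) h = begin
  length (f x ++ concatMap f xs)        ≡⟨ length-++ (f x) ⟩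
  length (f x) + length (concatMap f xs) ≤⟨ +-mono-≤ (h (here refl)) (length-concatMap-≤ f c xs (h ∘ there)) ⟩
  c + length xs * c                     ∎
  where open ≤-Reasoning

fromList : ∀ {n} → List (Fin n) → Subset n
fromList = foldr (λ x p → ⁅ x ⁆ ∪ p) ⊥

∈-fromList⁺ : ∀ {n} {x : Fin n} {xs} → x ∈ xs → x ∈ˢ fromList xs
∈-fromList⁺ {x = x} (here refl)  = Sub.x∈p∪q⁺ (inj₁ (Sub.x∈⁅x⁆ x))
∈-fromList⁺         (there x∈xs) = Sub.x∈p∪q⁺ (inj₂ (∈-fromList⁺ x∈xs))

∈-fromList⁻ : ∀ {n} {x : Fin n} xs → x ∈ˢ fromList xs → x ∈ xs
∈-fromList⁻ []       x∈ = contradiction x∈ Sub.∉⊥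
∈-fromList⁻ (y ∷ xs) x∈ with Sub.x∈p∪q⁻ ⁅ y ⁆ (fromList xs) x∈
... | inj₁ x∈y  = here (Sub.x∈⁅y⁆⇒x≡y y x∈y)
... | inj₂ x∈xs = there (∈-fromList⁻ xs x∈xs)

∣p∪q∣≤∣p∣+∣q∣ : ∀ {n} (p q : Subset n) → ∣ p ∪ q ∣ ≤ ∣ p ∣ + ∣ q ∣
∣p∪q∣≤∣p∣+∣q∣ []            []            = z≤n
∣p∪q∣≤∣p∣+∣q∣ (outside ∷ p) (outside ∷ q) = ∣p∪q∣≤∣p∣+∣q∣ p q
∣p∪q∣≤∣p∣+∣q∣ (outside ∷ p) (inside ∷ q)  = ≤-trans (s≤s (∣p∪q∣≤∣p∣+∣q∣ p q)) (≤-reflexive (sym (+-suc ∣ p ∣ ∣ q ∣)))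
∣p∪q∣≤∣p∣+∣q∣ (inside ∷ p)  (outside ∷ q) = s≤s (∣p∪q∣≤∣p∣+∣q∣ p q)
∣p∪q∣≤∣p∣+∣q∣ (inside ∷ p)  (inside ∷ q)  = s≤s (≤-trans (∣p∪q∣≤∣p∣+∣q∣ p q) (+-monoʳ-≤ ∣ p ∣ (n≤1+n ∣ q ∣)))

∣fromList∣≤length : ∀ {n} (xs : List (Fin n)) → ∣ fromList xs ∣ ≤ length xs
∣fromList∣≤length {n} [] = ≤-reflexive (Sub.∣⊥∣≡0 n)
∣fromList∣≤length (x ∷ xs) = begin
  ∣ ⁅ x ⁆ ∪ fromList xs ∣       ≤⟨ ∣p∪q∣≤∣p∣+∣q∣ ⁅ x ⁆ (fromList xs) ⟩
  ∣ ⁅ x ⁆ ∣ + ∣ fromList xs ∣   ≡⟨ cong (_+ ∣ fromList xs ∣) (Sub.∣⁅x⁆∣≡1 x) ⟩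
  suc ∣ fromList xs ∣           ≤⟨ s≤s (∣fromList∣≤length xs) ⟩
  suc (length xs)               ∎
  where open ≤-Reasoning

length≤∣fromList∣ : ∀ {n} {xs : List (Fin n)} → Unique xs → length xs ≤ ∣ fromList xs ∣
length≤∣fromList∣ {xs = []}     _        = z≤n
length≤∣fromList∣ {xs = x ∷ xs} (x∉ ∷ u) = ≤-trans (s≤s (length≤∣fromList∣ u)) (Sub.p⊂q⇒∣p∣<∣q∣
  ( (λ y∈ → Sub.x∈p∪q⁺ (inj₂ y∈))
  , x , Sub.x∈p∪q⁺ (inj₁ (Sub.x∈⁅x⁆ x)) , λ x∈ → All.lookup x∉ (∈-fromList⁻ xs x∈) refl))

∣p∣≤length : ∀ {n} {p : Subset n} xs → (∀ {x} → x ∈ˢ p → x ∈ xs) → ∣ p ∣ ≤ length xs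
∣p∣≤length xs p⊆xs = ≤-trans (Sub.p⊆q⇒∣p∣≤∣q∣ (∈-fromList⁺ ∘ p⊆xs)) (∣fromList∣≤length xs)

⊆-∣∣-antisym : ∀ {n} {p q : Subset n} → p ⊆ˢ q → ∣ q ∣ ≤ ∣ p ∣ → p ≡ q
⊆-∣∣-antisym {p = p} {q} p⊆q ∣q∣≤∣p∣ = Sub.⊆-antisym p⊆q q⊆p
  where
  q⊆p : q ⊆ˢ p
  q⊆p {x} x∈q with x Sub.∈? p
  ... | yes x∈p = x∈p
  ... | no  x∉p = contradiction (Sub.p⊂q⇒∣p∣<∣q∣ (p⊆q , x , x∈q , x∉p)) (≤⇒≯ ∣q∣≤∣p∣)

∣p-x∣ : ∀ {n} {p : Subset n} {x} → x ∈ˢ p → suc ∣ p - x ∣ ≡ ∣ p ∣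
∣p-x∣ {p = p} {x} x∈p = ≤-antisym (Sub.x∈p⇒∣p-x∣<∣p∣ x∈p) (begin
  ∣ p ∣                     ≤⟨ Sub.p⊆q⇒∣p∣≤∣q∣ sub ⟩
  ∣ ⁅ x ⁆ ∪ (p - x) ∣       ≤⟨ ∣p∪q∣≤∣p∣+∣q∣ ⁅ x ⁆ (p - x) ⟩
  ∣ ⁅ x ⁆ ∣ + ∣ p - x ∣     ≡⟨ cong (_+ ∣ p - x ∣) (Sub.∣⁅x⁆∣≡1 x) ⟩
  suc ∣ p - x ∣             ∎)
  where
  open ≤-Reasoning
  sub : p ⊆ˢ ⁅ x ⁆ ∪ (p - x)
  sub {y} y∈p with y Fin.≟ x
  ... | yes refl = Sub.x∈p∪q⁺ (inj₁ (Sub.x∈⁅x⁆ x))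
  ... | no  y≢x  = Sub.x∈p∪q⁺ (inj₂ (Sub.x∈p∧x≢y⇒x∈p-y y∈p y≢x))

-- The recursion follows Pascal's rule, so that the length of the list is a binomial coefficient.
subsetsOf : ∀ {n} → Subset n → ℕ → List (Subset n)
subsetsOf []            zero    = [] ∷ []
subsetsOf []            (suc r) = []
subsetsOf (outside ∷ p) r       = map (outside ∷_) (subsetsOf p r)
subsetsOf (inside ∷ p)  zero    = map (outside ∷_) (subsetsOf p zero)
subsetsOf (inside ∷ p)  (suc r) = map (inside ∷_) (subsetsOf p r) ++ map (outside ∷_) (subsetsOf p (suc r))

length-subsetsOf : ∀ {n} (p : Subset n) r → length (subsetsOf p r) ≡ ∣ p ∣ C r
length-subsetsOf []            zero    = refl
length-subsetsOf []            (suc r) = sym (k>n⇒nCk≡0 {0} {suc r} (s≤s z≤n))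
length-subsetsOf (outside ∷ p) r       = trans (length-map _ (subsetsOf p r)) (length-subsetsOf p r)
length-subsetsOf (inside ∷ p)  zero    = begin
  length (map (outside ∷_) (subsetsOf p zero)) ≡⟨ length-map _ (subsetsOf p zero) ⟩
  length (subsetsOf p zero)                    ≡⟨ length-subsetsOf p zero ⟩
  ∣ p ∣ C 0                                    ≡⟨ nC0≡1 ∣ p ∣ ⟩
  1                                            ≡⟨ nC0≡1 (suc ∣ p ∣) ⟨
  suc ∣ p ∣ C 0                                ∎
  where open ≡-Reasoning
length-subsetsOf (inside ∷ p)  (suc r) = begin
  length (map (inside ∷_) (subsetsOf p r) ++ map (outside ∷_) (subsetsOf p (suc r)))
    ≡⟨ length-++ (map (inside ∷_) (subsetsOf p r)) ⟩
  length (map (inside ∷_) (subsetsOf p r)) + length (map (outside ∷_) (subsetsOf p (suc r)))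
    ≡⟨ cong₂ _+_ (trans (length-map _ (subsetsOf p r)) (length-subsetsOf p r))
                 (trans (length-map _ (subsetsOf p (suc r))) (length-subsetsOf p (suc r))) ⟩
  ∣ p ∣ C r + ∣ p ∣ C suc r
    ≡⟨ pascal ∣ p ∣ r ⟨
  suc ∣ p ∣ C suc r ∎
  where open ≡-Reasoning

∈-subsetsOf : ∀ {n} (p : Subset n) {q} → q ⊆ˢ p → q ∈ subsetsOf p ∣ q ∣
∈-subsetsOf []            {[]}          _   = here refl
∈-subsetsOf (outside ∷ p) {outside ∷ q} q⊆p = ∈-map⁺ (outside ∷_) (∈-subsetsOf p (Sub.drop-∷-⊆ q⊆p))
∈-subsetsOf (outside ∷ p) {inside ∷ q}  q⊆p = contradiction (q⊆p here) λ ()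
∈-subsetsOf (inside ∷ p)  {inside ∷ q}  q⊆p = ∈-++⁺ˡ (∈-map⁺ (inside ∷_) (∈-subsetsOf p (Sub.drop-∷-⊆ q⊆p)))
∈-subsetsOf (inside ∷ p)  {outside ∷ q} q⊆p with ∣ q ∣ | ∈-subsetsOf p (Sub.drop-∷-⊆ q⊆p)
... | zero  | q∈ = ∈-map⁺ (outside ∷_) q∈
... | suc r | q∈ = ∈-++⁺ʳ (map (inside ∷_) (subsetsOf p r)) (∈-map⁺ (outside ∷_) q∈)

-- Serves twice: for all edges when a cycle spans, and for the off-path edges at a vertex with that
-- vertex deleted.
length-uniform : ∀ {n r} {T : Subset n} {ps : List (Subset n)} → Unique ps →
  (∀ {p} → p ∈ ps → p ⊆ˢ T × ∣ p ∣ ≡ r) → length ps ≤ ∣ T ∣ C r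
length-uniform {T = T} u h = ≤-trans
  (length-⊆ u (λ p∈ → let p⊆T , ∣p∣≡r = h p∈ in subst (λ r → _ ∈ subsetsOf T r) ∣p∣≡r (∈-subsetsOf T p⊆T)))
  (≤-reflexive (length-subsetsOf T _))

meets⁻ : ∀ {n} (p q : Subset n) → meets p q ≡ true → ∃ λ x → x ∈ˢ p × x ∈ˢ q
meets⁻ []            []            ()
meets⁻ (inside ∷ p)  (inside ∷ q)  _  = zero , here , here
meets⁻ (inside ∷ p)  (outside ∷ q) eq = let x , x∈p , x∈q = meets⁻ p q eq in suc x , there x∈p , there x∈q
meets⁻ (outside ∷ p) (_ ∷ q)       eq = let x , x∈p , x∈q = meets⁻ p q eq in suc x , there x∈p , there x∈q

-- Since r < k the binomial branch applies. The match down to two successors gets past the separate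
-- clause of `fr` for 1.
fr-binomial : ∀ q k → suc q < k → fr (suc q) k ≡ (ℤ.+ (k C q)) ℚ./ suc q
fr-binomial q (suc zero) (s≤s ())
fr-binomial q k@(suc (suc _)) q<k = if-false (≰⇒≤ᵇ≡false (<⇒≱ (≤-trans (n≤1+n (suc q)) q<k)))
  where
  if-false : ∀ {a} {A : Set a} {b} {x y : A} → b ≡ false → (if b then x else y) ≡ y
  if-false refl = refl
  ≰⇒≤ᵇ≡false : ∀ {m n} → ¬ m ≤ n → (m ≤ᵇ n) ≡ false
  ≰⇒≤ᵇ≡false {m} {n} m≰n with m ≤ᵇ n in eq
  ... | false = refl
  ... | true  = contradiction (≤ᵇ⇒≤ m n (subst T (sym eq) _)) m≰n

-- Clears the denominator r, so that all counting stays in the natural numbers. Unnormalised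
-- rationals avoid reducing the fractions.
ℕ-ratio-≤ : ∀ q a b c → suc q * a ≤ c * b → ℕtoℚ a ℚ.≤ (ℤ.+ c ℚ./ suc q) ℚ.* ℕtoℚ b
ℕ-ratio-≤ q a b c h = ℚₚ.toℚᵘ-cancel-≤ (begin
  ℚ.toℚᵘ (ℕtoℚ a)                                     ≃⟨ ℚₚ.toℚᵘ-fromℚᵘ (ℚᵘ.mkℚᵘ (ℤ.+ a) 0) ⟩
  ℚᵘ.mkℚᵘ (ℤ.+ a) 0                                   ≤⟨ ℚᵘ.*≤* num ⟩
  ℚᵘ.mkℚᵘ (ℤ.+ c) q ℚᵘ.* ℚᵘ.mkℚᵘ (ℤ.+ b) 0             ≃⟨ ℚᵘₚ.*-cong (ℚₚ.toℚᵘ-fromℚᵘ (ℚᵘ.mkℚᵘ (ℤ.+ c) q)) (ℚₚ.toℚᵘ-fromℚᵘ (ℚᵘ.mkℚᵘ (ℤ.+ b) 0)) ⟨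
  ℚ.toℚᵘ (ℤ.+ c ℚ./ suc q) ℚᵘ.* ℚ.toℚᵘ (ℕtoℚ b)       ≃⟨ ℚₚ.toℚᵘ-homo-* (ℤ.+ c ℚ./ suc q) (ℕtoℚ b) ⟨
  ℚ.toℚᵘ ((ℤ.+ c ℚ./ suc q) ℚ.* ℕtoℚ b)               ∎)
  where
  open ℚᵘₚ.≤-Reasoning
  num : ℤ.+ a ℤ.* ℤ.+ (suc q * 1) ℤ.≤ (ℤ.+ c ℤ.* ℤ.+ b) ℤ.* ℤ.+ 1
  num = subst₂ ℤ._≤_ (ℤₚ.pos-* a (suc q * 1)) (trans (ℤₚ.pos-* c b) (sym (ℤₚ.*-identityʳ (ℤ.+ c ℤ.* ℤ.+ b))))
    (ℤ.+≤+ (≤-trans (≤-reflexive (trans (cong (a *_) (*-identityʳ (suc q))) (*-comm a (suc q)))) h))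

-- Walks and their rotations

Unique-resp-↭ : ∀ {a} {A : Set a} {xs ys : List A} → xs ↭ ys → Unique xs → Unique ys
Unique-resp-↭ {A = A} = SetoidPermutation.Unique-resp-↭ (setoid A) ∘ ↭⇒↭ₛ

lookup-injective : ∀ {a} {A : Set a} {xs : List A} → Unique xs → Injective _≡_ _≡_ (lookup xs)
lookup-injective {xs = x ∷ xs} (x∉ ∷ u) {zero}  {zero}  eq = refl
lookup-injective {xs = x ∷ xs} (x∉ ∷ u) {zero}  {suc j} eq = contradiction eq (All.lookup x∉ (∈-lookup j))
lookup-injective {xs = x ∷ xs} (x∉ ∷ u) {suc i} {zero}  eq = contradiction (sym eq) (All.lookup x∉ (∈-lookup i))
lookup-injective {xs = x ∷ xs} (x∉ ∷ u) {suc i} {suc j} eq = cong suc (lookup-injective u eq)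

module _ {n : ℕ} (H : Hypergraph n) where

  -- Distinctness is kept apart, as a property of the lists of vertices and edges. A rotation then
  -- only has to be shown to permute these lists.
  data Walk : Fin n → Fin n → Set where
    stay : ∀ u → Walk u u
    step : ∀ {v w} u e → u ∈ˢ edge H e → v ∈ˢ edge H e → Walk v w → Walk u w

module _ {n : ℕ} {H : Hypergraph n} where

  verts : ∀ {u w} → Walk H u w → List (Fin n)
  verts (stay u)         = u ∷ []
  verts (step u e _ _ p) = u ∷ verts p

  edges : ∀ {u w} → Walk H u w → List (Fin (m H))
  edges (stay u)         = []
  edges (step u e _ _ p) = e ∷ edges p

  length-verts : ∀ {u w} (p : Walk H u w) → length (verts p) ≡ suc (length (edges p))
  length-verts (stay u)         = refl
  length-verts (step u e _ _ p) = cong suc (length-verts p)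

  start∈verts : ∀ {u w} (p : Walk H u w) → u ∈ verts p
  start∈verts (stay u)         = here refl
  start∈verts (step u e _ _ p) = here refl

  link : ∀ {u a b w} → Walk H u a → ∀ e → a ∈ˢ edge H e → b ∈ˢ edge H e → Walk H b w → Walk H u w
  link (stay u)           e a∈ b∈ q = step u e a∈ b∈ q
  link (step u f u∈ v∈ p) e a∈ b∈ q = step u f u∈ v∈ (link p e a∈ b∈ q)

  verts-link : ∀ {u a b w} (p : Walk H u a) {e} a∈ b∈ (q : Walk H b w) →
    verts (link p e a∈ b∈ q) ≡ verts p ++ verts q
  verts-link (stay u)         a∈ b∈ q = refl
  verts-link (step u f _ _ p) a∈ b∈ q = cong (u ∷_) (verts-link p a∈ b∈ q)

  edges-link : ∀ {u a b w} (p : Walk H u a) {e} a∈ b∈ (q : Walk H b w) →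
    edges (link p e a∈ b∈ q) ≡ edges p ++ e ∷ edges q
  edges-link (stay u)         a∈ b∈ q = refl
  edges-link (step u f _ _ p) a∈ b∈ q = cong (f ∷_) (edges-link p a∈ b∈ q)

  rev : ∀ {u w} → Walk H u w → Walk H w u
  rev (stay u)           = stay u
  rev (step u e u∈ v∈ p) = link (rev p) e v∈ u∈ (stay u)

  verts-rev : ∀ {u w} (p : Walk H u w) → verts (rev p) ↭ verts p
  verts-rev (stay u)           = ↭-refl
  verts-rev (step u e u∈ v∈ p) = begin
    verts (link (rev p) e v∈ u∈ (stay u)) ≡⟨ verts-link (rev p) v∈ u∈ (stay u) ⟩
    verts (rev p) ++ u ∷ []               ↭⟨ ∷↭∷ʳ u (verts (rev p)) ⟨
    u ∷ verts (rev p)                     ↭⟨ prep u (verts-rev p) ⟩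
    u ∷ verts p                           ∎
    where open PermutationReasoning

  edges-rev : ∀ {u w} (p : Walk H u w) → edges (rev p) ↭ edges p
  edges-rev (stay u)           = ↭-refl
  edges-rev (step u e u∈ v∈ p) = begin
    edges (link (rev p) e v∈ u∈ (stay u)) ≡⟨ edges-link (rev p) v∈ u∈ (stay u) ⟩
    edges (rev p) ++ e ∷ []               ↭⟨ ∷↭∷ʳ e (edges (rev p)) ⟨
    e ∷ edges (rev p)                     ↭⟨ prep e (edges-rev p) ⟩
    e ∷ edges p                           ∎
    where open PermutationReasoning

  record Split {u w : Fin n} (p : Walk H u w) : Set where
    constructor split
    field
      {tail head} : Fin n
      pre         : Walk H u tail
      mid         : Fin (m H)
      tail∈       : tail ∈ˢ edge H mid
      head∈       : head ∈ˢ edge H mid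
      post        : Walk H head w
      join        : p ≡ link pre mid tail∈ head∈ post

    rest : List (Fin (m H))
    rest = edges pre ++ edges post

    edges↭ : edges p ↭ mid ∷ rest
    edges↭ = begin
      edges p                                 ≡⟨ cong edges join ⟩
      edges (link pre mid tail∈ head∈ post)   ≡⟨ edges-link pre tail∈ head∈ post ⟩
      edges pre ++ mid ∷ edges post           ↭⟨ shift mid (edges pre) (edges post) ⟩
      mid ∷ rest                              ∎
      where open PermutationReasoning

    verts≡ : verts p ≡ verts pre ++ verts post
    verts≡ = trans (cong verts join) (verts-link pre tail∈ head∈ post)

    -- Pósa's rotation, with `tail` as the new start.
    rotate : ∀ f → u ∈ˢ edge H f → head ∈ˢ edge H f → Walk H tail w
    rotate f u∈ h∈ = link (rev pre) f u∈ h∈ post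

    verts-rotate : ∀ {f} u∈ h∈ → verts (rotate f u∈ h∈) ↭ verts p
    verts-rotate {f} u∈ h∈ = begin
      verts (rotate f u∈ h∈)          ≡⟨ verts-link (rev pre) u∈ h∈ post ⟩
      verts (rev pre) ++ verts post   ↭⟨ ++⁺ʳ (verts post) (verts-rev pre) ⟩
      verts pre ++ verts post         ≡⟨ verts≡ ⟨
      verts p                         ∎
      where open PermutationReasoning

    edges-rotate : ∀ {f} u∈ h∈ → edges (rotate f u∈ h∈) ↭ f ∷ rest
    edges-rotate {f} u∈ h∈ = begin
      edges (rotate f u∈ h∈)              ≡⟨ edges-link (rev pre) u∈ h∈ post ⟩
      edges (rev pre) ++ f ∷ edges post   ↭⟨ shift f (edges (rev pre)) (edges post) ⟩
      f ∷ edges (rev pre) ++ edges post   ↭⟨ prep f (++⁺ʳ (edges post) (edges-rev pre)) ⟩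
      f ∷ rest                            ∎
      where open PermutationReasoning

    -- When f closes the walk to a cycle, this opens the cycle at `mid` instead of at f.
    shiftAround : ∀ f → w ∈ˢ edge H f → u ∈ˢ edge H f → Walk H head tail
    shiftAround f w∈ u∈ = link post f w∈ u∈ pre

    verts-shiftAround : ∀ {f} w∈ u∈ → verts (shiftAround f w∈ u∈) ↭ verts p
    verts-shiftAround {f} w∈ u∈ = begin
      verts (shiftAround f w∈ u∈)   ≡⟨ verts-link post w∈ u∈ pre ⟩
      verts post ++ verts pre       ↭⟨ ++-comm (verts post) (verts pre) ⟩
      verts pre ++ verts post       ≡⟨ verts≡ ⟨
      verts p                       ∎
      where open PermutationReasoning

    edges-shiftAround : ∀ {f} w∈ u∈ → edges (shiftAround f w∈ u∈) ↭ f ∷ rest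
    edges-shiftAround {f} w∈ u∈ = begin
      edges (shiftAround f w∈ u∈)     ≡⟨ edges-link post w∈ u∈ pre ⟩
      edges post ++ f ∷ edges pre     ↭⟨ shift f (edges post) (edges pre) ⟩
      f ∷ edges post ++ edges pre     ↭⟨ prep f (++-comm (edges post) (edges pre)) ⟩
      f ∷ rest                        ∎
      where open PermutationReasoning

  open Split public

  splitLater : ∀ {u v w e} {u∈ : u ∈ˢ edge H e} {v∈ : v ∈ˢ edge H e} {p : Walk H v w} →
    Split p → Split (step u e u∈ v∈ p)
  splitLater {u} {e = e} {u∈} {v∈} (split pre f a∈ b∈ post eq) =
    split (step u e u∈ v∈ pre) f a∈ b∈ post (cong (step u e u∈ v∈) eq)

  splits : ∀ {u w} (p : Walk H u w) → List (Split p)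
  splits (stay u)           = []
  splits (step u e u∈ v∈ p) = split (stay u) e u∈ v∈ p refl ∷ map splitLater (splits p)

  length-splits : ∀ {u w} (p : Walk H u w) → length (splits p) ≡ length (edges p)
  length-splits (stay u)         = refl
  length-splits (step u e _ _ p) = cong suc (trans (length-map splitLater (splits p)) (length-splits p))

  map-mid-splits : ∀ {u w} (p : Walk H u w) → map mid (splits p) ≡ edges p
  map-mid-splits (stay u)         = refl
  map-mid-splits (step u e _ _ p) = cong (e ∷_) (trans (sym (map-∘ (splits p))) (map-mid-splits p))

  map-head-splits : ∀ {u w} (p : Walk H u w) → u ∷ map head (splits p) ≡ verts p
  map-head-splits (stay u)         = refl
  map-head-splits (step u e _ _ p) = cong (u ∷_) (trans (cong (_ ∷_) (sym (map-∘ (splits p)))) (map-head-splits p))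

  map-tail-splits : ∀ {u w} (p : Walk H u w) → w ∷ map tail (splits p) ↭ verts p
  map-tail-splits         (stay u)         = ↭-refl
  map-tail-splits {u} {w} (step u e _ _ p) = begin
    w ∷ u ∷ map tail (map splitLater (splits p)) ≡⟨ cong (λ ts → w ∷ u ∷ ts) (map-∘ (splits p)) ⟨
    w ∷ u ∷ map tail (splits p)                  ↭⟨ swap w u ↭-refl ⟩
    u ∷ w ∷ map tail (splits p)                  ↭⟨ prep u (map-tail-splits p) ⟩
    u ∷ verts p                                  ∎
    where open PermutationReasoning

  vertAt : ∀ {u w} (p : Walk H u w) → Fin (suc (length (edges p))) → Fin n
  vertAt {u} p                zero    = u
  vertAt     (step u e _ _ p) (suc i) = vertAt p i

  vertAt∈verts : ∀ {u w} (p : Walk H u w) i → vertAt p i ∈ verts p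
  vertAt∈verts p                zero    = start∈verts p
  vertAt∈verts (step u e _ _ p) (suc i) = there (vertAt∈verts p i)

  vertAt-injective : ∀ {u w} {p : Walk H u w} → Unique (verts p) → Injective _≡_ _≡_ (vertAt p)
  vertAt-injective                         _        {zero}  {zero}  eq = refl
  vertAt-injective {p = step u e _ _ p} (u∉ ∷ _) {zero}  {suc j} eq = contradiction eq (All.lookup u∉ (vertAt∈verts p j))
  vertAt-injective {p = step u e _ _ p} (u∉ ∷ _) {suc i} {zero}  eq = contradiction (sym eq) (All.lookup u∉ (vertAt∈verts p i))
  vertAt-injective {p = step u e _ _ p} (_ ∷ un) {suc i} {suc j} eq = cong suc (vertAt-injective un eq)

  toBerge : ∀ {u w} (p : Walk H u w) → Unique (verts p) → Unique (edges p) → BergePath H (length (edges p))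
  toBerge p uv ue = record
    { vert = vertAt p ; edg = lookup (edges p)
    ; vert-inj = vertAt-injective uv ; edg-inj = lookup-injective ue
    ; incid₀ = before p ; incid₁ = after p }
    where
    before : ∀ {u w} (p : Walk H u w) i → vertAt p (inject₁ i) ∈ˢ edge H (lookup (edges p) i)
    before (step u e u∈ v∈ p) zero    = u∈
    before (step u e u∈ v∈ p) (suc i) = before p i
    after : ∀ {u w} (p : Walk H u w) i → vertAt p (suc i) ∈ˢ edge H (lookup (edges p) i)
    after (step u e u∈ v∈ p) zero    = v∈
    after (step u e u∈ v∈ p) (suc i) = after p i

  -- Plain functions without injectivity let the recursion shift both sequences by one.
  fromIncidences : ∀ k (v : Fin (suc k) → Fin n) (e : Fin k → Fin (m H)) →
    (∀ i → v (inject₁ i) ∈ˢ edge H (e i)) → (∀ i → v (suc i) ∈ˢ edge H (e i)) →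
    Σ (Walk H (v zero) (v (fromℕ k))) λ p → verts p ≡ tabulate v × edges p ≡ tabulate e
  fromIncidences zero    v e i₀ i₁ = stay (v zero) , refl , refl
  fromIncidences (suc k) v e i₀ i₁ =
    let p , vs , es = fromIncidences k (v ∘ suc) (e ∘ suc) (i₀ ∘ suc) (i₁ ∘ suc)
    in step (v zero) (e zero) (i₀ zero) (i₁ zero) p , cong (v zero ∷_) vs , cong (e zero ∷_) es

  fromBerge : ∀ {k} (P : BergePath H k) → Σ (Walk H (vert P zero) (vert P (fromℕ k))) λ p →
    verts p ≡ tabulate (vert P) × edges p ≡ tabulate (edg P)
  fromBerge {k} P = fromIncidences k (vert P) (edg P) (incid₀ P) (incid₁ P)

-- Longest paths

module Extremal {n q k : ℕ} (H : Hypergraph n) (uniform : Uniform (suc q) H) (2≤q : 2 ≤ q) (r<k : suc q < k)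
  (connected : Connected H) (longest : ∀ ℓ → BergePath H ℓ → ℓ ≤ k) where

  E : Set
  E = Fin (m H)

  infix 4 _∈ᴱ_
  _∈ᴱ_ : Fin n → E → Set
  v ∈ᴱ e = v ∈ˢ edge H e

  _∈ᴱ?_ : ∀ v e → Dec (v ∈ᴱ e)
  v ∈ᴱ? e = v Sub.∈? edge H e

  record Goal : Set where
    constructor goodSet
    field
      S    : Subset n
      good : GoodSet H (suc q) k S
      size : ∣ S ∣ < n ⊎ n ≡ k + 1

  -- The path edges are recorded up to order: rotating along an edge of the path itself then keeps the index es.
  record LongestPath (u w : Fin n) (es : List E) : Set where
    constructor longestPath
    field
      walk         : Walk H u w
      verts-unique : Unique (verts walk)
      edges-walk   : edges walk ↭ es
      es-unique    : Unique es
      es-length    : length es ≡ k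

    edges-unique : Unique (edges walk)
    edges-unique = Unique-resp-↭ (↭-sym edges-walk) es-unique

    edges-length : length (edges walk) ≡ k
    edges-length = trans (↭-length edges-walk) es-length

    verts-length : length (verts walk) ≡ suc k
    verts-length = trans (length-verts walk) (cong suc edges-length)

  open LongestPath

  module _ {u w es} (p : LongestPath u w es) where

    -- A vertex of f off the path could be put in front of u by means of f, giving a Berge path of
    -- length k + 1.
    start-edge-covered : ∀ {f} → u ∈ᴱ f → f ∉ es → ∀ {y} → y ∈ᴱ f → y ∈ verts (walk p)
    start-edge-covered {f} u∈f f∉ {y} y∈f with _∈?_ Fin._≟_ y (verts (walk p))
    ... | yes y∈ = y∈
    ... | no  y∉ = contradiction (longest _ (toBerge (step y f y∈f u∈f (walk p)) (unique-∷ y∉ (verts-unique p))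
                     (unique-∷ (f∉ ∘ ∈-resp-↭ (edges-walk p)) (edges-unique p))))
                   (<⇒≱ (s≤s (≤-reflexive (sym (edges-length p)))))

    reverse-path : LongestPath w u es
    reverse-path = longestPath (rev (walk p)) (Unique-resp-↭ (↭-sym (verts-rev (walk p))) (verts-unique p))
      (↭-trans (edges-rev (walk p)) (edges-walk p)) (es-unique p) (es-length p)

    rest⊆es : (s : Split (walk p)) → ∀ {e} → e ∈ rest s → e ∈ es
    rest⊆es s = ∈-resp-↭ (edges-walk p) ∘ ∈-resp-↭ (↭-sym (edges↭ s)) ∘ there

    mid-rest-unique : (s : Split (walk p)) → Unique (mid s ∷ rest s)
    mid-rest-unique s = Unique-resp-↭ (edges↭ s) (edges-unique p)

    -- Shared by rotations and by shifts of a cycle: the vertices are only permuted and one path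
    -- edge is traded for a new one, so length and distinctness survive.
    exchange : ∀ {a b f} (s : Split (walk p)) (x : Walk H a b) → verts x ↭ verts (walk p) → edges x ↭ f ∷ rest s →
      f ∉ es → LongestPath a b (f ∷ rest s)
    exchange s x vs fs f∉ = longestPath x (Unique-resp-↭ (↭-sym vs) (verts-unique p)) fs
      (unique-∷ (f∉ ∘ rest⊆es s) (unique-tail (mid-rest-unique s)))
      (trans (sym (↭-length (edges↭ s))) (edges-length p))

    rotate-new : ∀ {f} (s : Split (walk p)) → u ∈ᴱ f → head s ∈ᴱ f → f ∉ es → LongestPath (tail s) w (f ∷ rest s)
    rotate-new s u∈ h∈ = exchange s (rotate s _ u∈ h∈) (verts-rotate s u∈ h∈) (edges-rotate s u∈ h∈)

    -- The released edge `mid s` contains u, so it can itself join u to `head s`; hence the index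
    -- `es` is kept.
    rotate-own : (s : Split (walk p)) → u ∈ᴱ mid s → LongestPath (tail s) w es
    rotate-own s u∈ = longestPath (rotate s _ u∈ (head∈ s))
      (Unique-resp-↭ (↭-sym (verts-rotate s u∈ (head∈ s))) (verts-unique p))
      (↭-trans (edges-rotate s u∈ (head∈ s)) (↭-trans (↭-sym (edges↭ s)) (edges-walk p)))
      (es-unique p) (es-length p)

    split-at : ∀ {v} → v ∈ verts (walk p) → v ≢ u → ∃ λ (s : Split (walk p)) → s ∈ splits (walk p) × v ≡ head s
    split-at v∈ v≢u with subst (_ ∈_) (sym (map-head-splits (walk p))) v∈
    ... | here v≡u = contradiction v≡u v≢u
    ... | there v∈ = ∈-map⁻ head v∈

    split-at-tail : ∀ {v} → v ∈ verts (walk p) → v ≢ w → ∃ λ (s : Split (walk p)) → s ∈ splits (walk p) × v ≡ tail s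
    split-at-tail v∈ v≢w with ∈-resp-↭ (↭-sym (map-tail-splits (walk p))) v∈
    ... | here v≡w = contradiction v≡w v≢w
    ... | there v∈ = ∈-map⁻ tail v∈

    split-mid : ∀ {e} → e ∈ es → ∃ λ (s : Split (walk p)) → s ∈ splits (walk p) × e ≡ mid s
    split-mid e∈ = ∈-map⁻ mid (subst (_ ∈_) (sym (map-mid-splits (walk p))) (∈-resp-↭ (↭-sym (edges-walk p)) e∈))

    k<n : suc k ≤ n
    k<n = begin
      suc k                   ≡⟨ verts-length p ⟨
      length (verts (walk p)) ≤⟨ length-⊆ (verts-unique p) (λ {x} _ → ∈-allFin x) ⟩
      length (allFin n)       ≡⟨ length-tabulate (λ i → i) ⟩
      n                       ∎
      where open ≤-Reasoning

  Endpoint : Fin n → Set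
  Endpoint u = ∃₂ λ w es → LongestPath u w es

  another-vertex : ∀ f u → ∃ λ y → y ∈ᴱ f × y ≢ u
  another-vertex f u with Fin.any? (λ y → (y ∈ᴱ? f) ×-dec ¬? (y Fin.≟ u))
  ... | yes found = found
  ... | no  none  = contradiction (∣p∣≤length {p = edge H f} (u ∷ []) only-u) (<⇒≱ 1<∣f∣)
    where
    only-u : ∀ {y} → y ∈ᴱ f → y ∈ u ∷ []
    only-u {y} y∈ with y Fin.≟ u
    ... | yes y≡u = here y≡u
    ... | no  y≢u = contradiction (y , y∈ , y≢u) none
    1<∣f∣ : 1 < ∣ edge H f ∣
    1<∣f∣ = subst (1 <_) (sym (uniform f)) (s≤s (≤-trans (s≤s z≤n) 2≤q))

  -- An edge f off the path lies inside it, so a second vertex of f is the head of some cut, and the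
  -- rotation there puts f on a longest path.
  endpoint-edge : ∀ {u f} → Endpoint u → u ∈ᴱ f → ∃ λ u′ → ∃₂ λ w es → LongestPath u′ w es × f ∈ es
  endpoint-edge {u} {f} (w , es , p) u∈f with _∈?_ Fin._≟_ f es
  ... | yes f∈ = u , w , es , p , f∈
  ... | no  f∉ with another-vertex f u
  ...   | y , y∈f , y≢u with split-at p (start-edge-covered p u∈f f∉ y∈f) y≢u
  ...     | s , _ , refl = tail s , w , f ∷ rest s , rotate-new p s u∈f y∈f f∉ , here refl

  path-number : ∀ {u f} → Endpoint u → u ∈ᴱ f → PathNumber H f k
  path-number {u} {f} end u∈f with endpoint-edge end u∈f
  ... | u′ , w , es , p , f∈es =
    subst (λ ℓ → Σ (BergePath H ℓ) λ P → Uses P f) (edges-length p)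
      (toBerge (walk p) (verts-unique p) (edges-unique p) , index f∈ , sym (Any.lookup-index f∈))
    , λ ℓ P _ → longest ℓ P
    where f∈ = ∈-resp-↭ (↭-sym (edges-walk p)) f∈es

  -- Reduces goodness to a count. M may be any list that covers the edges meeting L, repetitions
  -- allowed, since only an upper bound for |N(S)| is wanted.
  goal-from-ends : (L : List (Fin n)) → Unique L → 1 ≤ length L → (∀ {v} → v ∈ L → Endpoint v) →
    (M : List E) → (∀ {e v} → v ∈ L → v ∈ᴱ e → e ∈ M) →
    suc q * length M ≤ (k C q) * length L → (length L < n ⊎ n ≡ k + 1) → Goal
  goal-from-ends L@(v ∷ _) uniq _ ends M cover bound size =
    goodSet (fromList L) ((v , ∈-fromList⁺ {xs = L} (here refl)) , on-longest , ratio) (subst (λ s → s < n ⊎ n ≡ k + 1) (sym ∣S∣) size)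
    where
    ∣S∣ : ∣ fromList L ∣ ≡ length L
    ∣S∣ = ≤-antisym (∣fromList∣≤length L) (length≤∣fromList∣ uniq)
    meeting : ∀ e → e ∈ˢ Nbhd H (fromList L) → ∃ λ v → v ∈ L × v ∈ᴱ e
    meeting e e∈ with meets⁻ (edge H e) (fromList L) (trans (sym (Vec.lookup∘tabulate _ e)) (Vec.[]=⇒lookup e∈))
    ... | v , v∈e , v∈S = v , ∈-fromList⁻ L v∈S , v∈e
    on-longest : ∀ e → e ∈ˢ Nbhd H (fromList L) → PathNumber H e k
    on-longest e e∈ = let v , v∈L , v∈e = meeting e e∈ in path-number (ends v∈L) v∈e
    ratio = subst (λ f → ℕtoℚ ∣ Nbhd H (fromList L) ∣ ℚ.≤ f ℚ.* ℕtoℚ ∣ fromList L ∣) (sym (fr-binomial q k r<k))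
      (ℕ-ratio-≤ q _ _ (k C q) (begin
        suc q * ∣ Nbhd H (fromList L) ∣
          ≤⟨ *-monoʳ-≤ (suc q) (∣p∣≤length M λ {e} e∈ → let v , v∈L , v∈e = meeting e e∈ in cover v∈L v∈e) ⟩
        suc q * length M      ≤⟨ bound ⟩
        (k C q) * length L    ≡⟨ cong ((k C q) *_) ∣S∣ ⟨
        (k C q) * ∣ fromList L ∣ ∎))
      where open ≤-Reasoning

  longest-path : (P : BergePath H k) → ∃₂ λ u w → ∃ λ es → LongestPath u w es
  longest-path P with fromBerge P
  ... | x , vs , es = _ , _ , tabulate (edg P) , longestPath x
    (subst Unique (sym vs) (Unique.tabulate⁺ (vert-inj P))) (↭-reflexive es)
    (Unique.tabulate⁺ (edg-inj P)) (length-tabulate (edg P))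

  -- Longest paths that close up to a Berge cycle

  record Cycle : Set where
    constructor cycle
    field
      {u w} : Fin n
      {es}  : List E
      path  : LongestPath u w es
      f     : E
      f∉    : f ∉ es
      u∈    : u ∈ᴱ f
      w∈    : w ∈ᴱ f

  -- Some step of the walk is the first to leave V.
  crossing : ∀ {u w} (p : Walk H u w) (V : List (Fin n)) → u ∈ V → w ∉ V →
    ∃ λ g → ∃₂ λ a b → a ∈ V × b ∉ V × a ∈ᴱ g × b ∈ᴱ g
  crossing (stay u) V u∈ w∉ = contradiction u∈ w∉
  crossing (step {v} u e u∈e v∈e p) V u∈ w∉ with _∈?_ Fin._≟_ v V
  ... | yes v∈ = crossing p V v∈ w∉
  ... | no  v∉ = e , u , v , u∈ , v∉ , u∈e , v∈e

  module _ (c : Cycle) where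
    open Cycle c

    shifted : (s : Split (walk path)) → LongestPath (head s) (tail s) (f ∷ rest s)
    shifted s = exchange path s (shiftAround s f w∈ u∈) (verts-shiftAround s w∈ u∈) (edges-shiftAround s w∈ u∈) f∉

    on-cycle-endpoint : ∀ {v} → v ∈ verts (walk path) → Endpoint v
    on-cycle-endpoint {v} v∈ with v Fin.≟ u
    ... | yes refl = w , es , path
    ... | no  v≢u with split-at path v∈ v≢u
    ...   | s , _ , refl = tail s , f ∷ rest s , shifted s

    -- The cycle is opened at a vertex of g so that g is off the resulting longest path; by
    -- `start-edge-covered` all of g then lies on the cycle.
    no-crossing : ∀ {g a b} → a ∈ verts (walk path) → b ∉ verts (walk path) → a ∈ᴱ g → ¬ b ∈ᴱ g
    no-crossing {g} {a} {b} a∈ b∉ a∈g b∈g with _∈?_ Fin._≟_ g es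
    ... | yes g∈ with split-mid path g∈
    ...   | s , _ , refl = b∉ (∈-resp-↭ (verts-shiftAround s w∈ u∈) (start-edge-covered (shifted s) (head∈ s) mid∉ b∈g))
      where
      mid∉ : mid s ∉ f ∷ rest s
      mid∉ (here refl) = f∉ g∈
      mid∉ (there g∈r) = ∉-tail (mid-rest-unique path s) g∈r
    no-crossing {g} {a} {b} a∈ b∉ a∈g b∈g | no g∉ with a Fin.≟ u
    ... | yes refl = b∉ (start-edge-covered path a∈g g∉ b∈g)
    ... | no  a≢u with g Fin.≟ f
    ...   | yes refl = b∉ (start-edge-covered path u∈ f∉ b∈g)
    ...   | no  g≢f with split-at path a∈ a≢u
    ...     | s , _ , refl = b∉ (∈-resp-↭ (verts-shiftAround s w∈ u∈) (start-edge-covered (shifted s) a∈g g∉′ b∈g))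
      where
      g∉′ : g ∉ f ∷ rest s
      g∉′ (here g≡f)  = g≢f g≡f
      g∉′ (there g∈r) = g∉ (rest⊆es path s g∈r)

    -- By connectedness a Berge path leads from u to a missed vertex; one of its edges would leave
    -- the cycle, against `no-crossing`.
    cycle-spans : ∀ z → z ∈ verts (walk path)
    cycle-spans z with _∈?_ Fin._≟_ z (verts (walk path))
    ... | yes z∈ = z∈
    ... | no  z∉ with connected u z (λ { refl → z∉ (start∈verts (walk path)) })
    ...   | ℓ , P , refl , refl with crossing (proj₁ (fromBerge P)) (verts (walk path)) (start∈verts (walk path)) z∉
    ...     | g , a , b , a∈ , b∉ , a∈g , b∈g = contradiction b∈g (no-crossing a∈ b∉ a∈g)

    -- Here S is the whole vertex set, the one case that yields n = k + 1 instead of |S| < n.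
    cycle⇒goal : Goal
    cycle⇒goal = goal-from-ends (verts (walk path)) (verts-unique path) (subst (1 ≤_) (sym (verts-length path)) (s≤s z≤n))
      on-cycle-endpoint (allFin (m H)) (λ {e} _ _ → ∈-allFin e) bound (inj₂ n≡k+1)
      where
      n≡k+1 : n ≡ k + 1
      n≡k+1 = trans (≤-antisym (begin
        n                          ≡⟨ length-tabulate (λ i → i) ⟨
        length (allFin n)          ≤⟨ length-⊆ (Unique.allFin⁺ n) (λ {z} _ → cycle-spans z) ⟩
        length (verts (walk path)) ≡⟨ verts-length path ⟩
        suc k                      ∎) (k<n path)) (+-comm 1 k)
        where open ≤-Reasoning
      bound : suc q * length (allFin (m H)) ≤ (k C q) * length (verts (walk path))
      bound = begin
        suc q * length (allFin (m H))
          ≡⟨ cong (suc q *_) (length-map (edge H) (allFin (m H))) ⟨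
        suc q * length (map (edge H) (allFin (m H)))
          ≤⟨ *-monoʳ-≤ (suc q) (length-uniform {T = ⊤} (Unique.map⁺ (simple H) (Unique.allFin⁺ (m H))) sub) ⟩
        suc q * (∣ ⊤ {n} ∣ C suc q)
          ≡⟨ cong (λ a → suc q * (a C suc q)) (trans (Sub.∣⊤∣≡n n) (trans n≡k+1 (+-comm k 1))) ⟩
        suc q * (suc k C suc q)
          ≡⟨ C-absorb k q ⟩
        suc k * (k C q)
          ≡⟨ *-comm (suc k) (k C q) ⟩
        (k C q) * suc k
          ≡⟨ cong ((k C q) *_) (verts-length path) ⟨
        (k C q) * length (verts (walk path)) ∎
        where
        open ≤-Reasoning
        sub : ∀ {p} → p ∈ map (edge H) (allFin (m H)) → p ⊆ˢ ⊤ × ∣ p ∣ ≡ suc q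
        sub p∈ with ∈-map⁻ (edge H) p∈
        ... | e , _ , refl = (λ _ → Sub.∈⊤) , uniform e

  -- Off-path edges and off-path neighbours

  offPath : List E → Fin n → List E
  offPath es v = filter (λ e → (v ∈ᴱ? e) ×-dec ¬? (_∈?_ Fin._≟_ e es)) (allFin (m H))

  ∈-offPath⁺ : ∀ {es v e} → v ∈ᴱ e → e ∉ es → e ∈ offPath es v
  ∈-offPath⁺ {e = e} v∈ e∉ = ∈-filter⁺ _ (∈-allFin e) (v∈ , e∉)

  ∈-offPath⁻ : ∀ {es v e} → e ∈ offPath es v → v ∈ᴱ e × e ∉ es
  ∈-offPath⁻ {es} {v} e∈ = proj₂ (∈-filter⁻ (λ e → (v ∈ᴱ? e) ×-dec ¬? (_∈?_ Fin._≟_ e es)) {xs = allFin (m H)} e∈)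

  nbr? : ∀ es v → Decidable (λ y → y ≢ v × Any (y ∈ᴱ_) (offPath es v))
  nbr? es v y = ¬? (y Fin.≟ v) ×-dec any? (y ∈ᴱ?_) (offPath es v)

  nbrs : List E → Fin n → List (Fin n)
  nbrs es v = filter (nbr? es v) (allFin n)

  nbrs-unique : ∀ es v → Unique (nbrs es v)
  nbrs-unique es v = Unique.filter⁺ (nbr? es v) (Unique.allFin⁺ n)

  ∈-nbrs⁺ : ∀ {es v y e} → v ∈ᴱ e → e ∉ es → y ∈ᴱ e → y ≢ v → y ∈ nbrs es v
  ∈-nbrs⁺ {es} {v} {y} v∈ e∉ y∈ y≢v = ∈-filter⁺ (nbr? es v) (∈-allFin y) (y≢v , lose (∈-offPath⁺ v∈ e∉) y∈)

  ∈-nbrs⁻ : ∀ {es v y} → y ∈ nbrs es v → y ≢ v × ∃ λ e → v ∈ᴱ e × e ∉ es × y ∈ᴱ e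
  ∈-nbrs⁻ {es} {v} y∈ with ∈-filter⁻ (nbr? es v) {xs = allFin n} y∈
  ... | _ , y≢v , y∈any with find y∈any
  ...   | e , e∈ , y∈e = let v∈ , e∉ = ∈-offPath⁻ {es} {v} e∈ in y≢v , e , v∈ , e∉ , y∈e

  -- Deleting v turns the off-path edges at v into q-element sets of off-path neighbours. The map is
  -- injective because every such edge contains v.
  length-offPath : ∀ es v → length (offPath es v) ≤ length (nbrs es v) C q
  length-offPath es v = begin
    length (offPath es v)                  ≡⟨ length-map link-at (offPath es v) ⟨
    length (map link-at (offPath es v))    ≤⟨ length-uniform {T = fromList (nbrs es v)} uniq in-nbrs ⟩
    ∣ fromList (nbrs es v) ∣ C q           ≤⟨ C-monoˡ-≤ q (∣fromList∣≤length (nbrs es v)) ⟩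
    length (nbrs es v) C q                 ∎
    where
    open ≤-Reasoning
    link-at : E → Subset n
    link-at e = edge H e - v
    link-⊆ : ∀ {e e′} → v ∈ᴱ e′ → link-at e ≡ link-at e′ → edge H e ⊆ˢ edge H e′
    link-⊆ {e} {e′} v∈e′ eq {x} x∈e with x Fin.≟ v
    ... | yes refl = v∈e′
    ... | no  x≢v  = Sub.p─q⊆p (edge H e′) _ (subst (x ∈ˢ_) eq (Sub.x∈p∧x≢y⇒x∈p-y x∈e x≢v))
    uniq : Unique (map link-at (offPath es v))
    uniq = map-unique link-at (Unique.filter⁺ _ (Unique.allFin⁺ (m H))) λ x∈ y∈ eq →
      simple H (Sub.⊆-antisym (link-⊆ (proj₁ (∈-offPath⁻ {es} y∈)) eq) (link-⊆ (proj₁ (∈-offPath⁻ {es} x∈)) (sym eq)))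
    in-nbrs : ∀ {p} → p ∈ map link-at (offPath es v) → p ⊆ˢ fromList (nbrs es v) × ∣ p ∣ ≡ q
    in-nbrs p∈ with ∈-map⁻ link-at p∈
    ... | e , e∈ , refl = let v∈ , e∉ = ∈-offPath⁻ {es} e∈ in
      -- The case y = v is excluded: deleting v a second time would shrink the set, although
      -- deletion is idempotent.
      (λ {y} y∈ → ∈-fromList⁺ (∈-nbrs⁺ v∈ e∉ (Sub.p─q⊆p (edge H e) _ y∈)
        λ { refl → <-irrefl (cong ∣_∣ (Sub.p─q─q≡p─q (edge H e) ⁅ v ⁆)) (Sub.x∈p⇒∣p-x∣<∣p∣ y∈) }))
      , suc-injective (trans (∣p-x∣ v∈) (uniform e))

  module _ {u w es} (p : LongestPath u w es) where

    -- Rotating along f makes `tail s` the start, and g joins it to the unchanged end w. If f = g,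
    -- this edge contains both u and w and closes p directly.
    cross : (s : Split (walk p)) → ∀ {f g} → f ∉ es → u ∈ᴱ f → head s ∈ᴱ f → g ∉ es → w ∈ᴱ g → tail s ∈ᴱ g → Cycle
    cross s {f} {g} f∉ u∈f h∈f g∉ w∈g t∈g with f Fin.≟ g
    ... | yes refl = cycle p f f∉ u∈f w∈g
    ... | no  f≢g  = cycle (rotate-new p s u∈f h∈f f∉) g
      (λ { (here g≡f) → f≢g (sym g≡f) ; (there g∈r) → g∉ (rest⊆es p s g∈r) }) t∈g w∈g

    -- As in `cross`, but the rotation reuses a path edge, so g is automatically a new edge.
    cross-own : (s : Split (walk p)) → ∀ {g} → u ∈ᴱ mid s → g ∉ es → w ∈ᴱ g → tail s ∈ᴱ g → Cycle
    cross-own s u∈ g∉ w∈ t∈ = cycle (rotate-own p s u∈) _ g∉ t∈ w∈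

    -- The predecessors of the off-path neighbours of u are ends of longest paths from w, so they are not off-path neighbours of w.
    nbrs-sum : Cycle ⊎ length (nbrs es u) + length (nbrs es w) ≤ k
    nbrs-sum with any? (λ s → (head s ∈ⱽ? nbrs es u) ×-dec (tail s ∈ⱽ? nbrs es w)) (splits (walk p))
      where _∈ⱽ?_ = _∈?_ Fin._≟_
    ... | yes crossed with find crossed
    ...   | s , _ , h∈ , t∈ with ∈-nbrs⁻ {es} h∈ | ∈-nbrs⁻ {es} t∈
    ...     | _ , f , u∈f , f∉ , h∈f | _ , g , w∈g , g∉ , t∈g = inj₁ (cross s f∉ u∈f h∈f g∉ w∈g t∈g)
    nbrs-sum | no none = inj₂ (begin
      length (nbrs es u) + length (nbrs es w)
        ≤⟨ +-mono-≤ (length-⊆ (nbrs-unique es u) heads) (length-⊆ (nbrs-unique es w) tails) ⟩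
      length (map head (filter head? ss)) + length (map tail (filter tail? ss))
        ≡⟨ cong₂ _+_ (length-map head (filter head? ss)) (length-map tail (filter tail? ss)) ⟩
      length (filter head? ss) + length (filter tail? ss)
        ≤⟨ length-filter-disjoint head? tail? ss (λ s∈ h∈ t∈ → none (lose s∈ (h∈ , t∈))) ⟩
      length ss
        ≡⟨ trans (length-splits (walk p)) (edges-length p) ⟩
      k ∎)
      where
      open ≤-Reasoning
      ss = splits (walk p)
      head? : Decidable (λ (s : Split (walk p)) → head s ∈ nbrs es u)
      head? s = _∈?_ Fin._≟_ (head s) (nbrs es u)
      tail? : Decidable (λ (s : Split (walk p)) → tail s ∈ nbrs es w)
      tail? s = _∈?_ Fin._≟_ (tail s) (nbrs es w)
      heads : ∀ {y} → y ∈ nbrs es u → y ∈ map head (filter head? ss)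
      heads y∈ with ∈-nbrs⁻ {es} y∈
      ... | y≢u , f , u∈f , f∉ , y∈f with split-at p (start-edge-covered p u∈f f∉ y∈f) y≢u
      ...   | s , s∈ , refl = ∈-map⁺ head (∈-filter⁺ head? s∈ y∈)
      tails : ∀ {y} → y ∈ nbrs es w → y ∈ map tail (filter tail? ss)
      tails y∈ with ∈-nbrs⁻ {es} y∈
      ... | y≢w , f , w∈f , f∉ , y∈f
          with split-at-tail p (∈-resp-↭ (verts-rev (walk p)) (start-edge-covered (reverse-path p) w∈f f∉ y∈f)) y≢w
      ...   | s , s∈ , refl = ∈-map⁺ tail (∈-filter⁺ tail? s∈ y∈)

    -- Ends reached by rotating along path edges

    startSplits : List (Split (walk p))
    startSplits = filter (λ s → u ∈ᴱ? mid s) (splits (walk p))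

    -- Tails of different cuts differ, so the number of these ends is also the number of path edges
    -- at u. Both counts in `count-bound` rest on this.
    rotations : List (Fin n)
    rotations = map tail startSplits

    rotations-unique : Unique rotations
    rotations-unique = AllPairs.map⁺ (AllPairs.filter⁺ _ (AllPairs.map⁻ (unique-tail
      (Unique-resp-↭ (↭-sym (map-tail-splits (walk p))) (verts-unique p)))))

    rotate-to : ∀ {v} → v ∈ rotations → LongestPath v w es
    rotate-to v∈ with ∈-map∘filter⁻ tail (λ s → u ∈ᴱ? mid s) {xs = splits (walk p)} v∈
    ... | s , _ , refl , u∈ = rotate-own p s u∈

    -- The rotation at the first edge gives back u.
    start∈rotations : u ∈ rotations
    start∈rotations with walk p | edges-length p
    ... | step u e u∈ v∈ x | _  = ∈-map∘filter⁺ tail (λ s → u ∈ᴱ? mid s) (_ , here refl , refl , u∈)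
    ... | stay u           | eq = contradiction r<k (subst (λ k → ¬ suc q < k) eq λ ())

    1≤rotations : 1 ≤ length rotations
    1≤rotations = length-⊆ {xs = u ∷ []} ([] ∷ []) (λ { (here refl) → start∈rotations })

    rotations≤k : length rotations ≤ k
    rotations≤k = begin
      length rotations          ≡⟨ length-map tail startSplits ⟩
      length startSplits        ≤⟨ length-filter _ (splits (walk p)) ⟩
      length (splits (walk p))  ≡⟨ trans (length-splits (walk p)) (edges-length p) ⟩
      k                         ∎
      where open ≤-Reasoning

    -- The edges at u are the off-path ones and one path edge for each rotation.
    start-good : suc q * (length rotations + length (offPath es u)) ≤ k C q → Goal
    start-good bound = goal-from-ends (u ∷ []) ([] ∷ []) (s≤s z≤n) (λ { (here refl) → w , es , p })
      (map mid startSplits ++ offPath es u) (λ { (here refl) → cover }) (begin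
        suc q * length (map mid startSplits ++ offPath es u)
          ≡⟨ cong (suc q *_) (length-++ (map mid startSplits)) ⟩
        suc q * (length (map mid startSplits) + length (offPath es u))
          ≡⟨ cong (λ a → suc q * (a + length (offPath es u))) (trans (length-map mid startSplits) (sym (length-map tail startSplits))) ⟩
        suc q * (length rotations + length (offPath es u))
          ≤⟨ bound ⟩
        k C q
          ≡⟨ *-identityʳ (k C q) ⟨
        (k C q) * 1 ∎)
      (inj₁ (≤-trans (s≤s (≤-trans (s≤s z≤n) r<k)) (k<n p)))
      where
      open ≤-Reasoning
      cover : ∀ {e} → u ∈ᴱ e → e ∈ map mid startSplits ++ offPath es u
      cover {e} u∈e with _∈?_ Fin._≟_ e es
      ... | no  e∉ = ∈-++⁺ʳ (map mid startSplits) (∈-offPath⁺ u∈e e∉)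
      ... | yes e∈ with split-mid p e∈
      ...   | s , s∈ , refl = ∈-++⁺ˡ (∈-map∘filter⁺ mid (λ s → u ∈ᴱ? mid s) (s , s∈ , refl , u∈e))

    -- All rotated ends belong to paths with the same edges `es`, so these k edges are counted only
    -- once.
    rotations-good : ∀ c → (∀ {v} → v ∈ rotations → length (offPath es v) ≤ c) →
      suc q * (k + length rotations * c) ≤ (k C q) * length rotations → Goal
    rotations-good c off bound = goal-from-ends rotations rotations-unique 1≤rotations (λ v∈ → w , es , rotate-to v∈)
      (es ++ concatMap (offPath es) rotations) cover (≤-trans (*-monoʳ-≤ (suc q) (begin
        length (es ++ concatMap (offPath es) rotations)        ≡⟨ length-++ es ⟩
        length es + length (concatMap (offPath es) rotations)  ≤⟨ +-mono-≤ (≤-reflexive (es-length p)) (length-concatMap-≤ (offPath es) c rotations off) ⟩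
        k + length rotations * c                               ∎)) bound)
      (inj₁ (≤-trans (s≤s rotations≤k) (k<n p)))
      where
      open ≤-Reasoning
      cover : ∀ {e v} → v ∈ rotations → v ∈ᴱ e → e ∈ es ++ concatMap (offPath es) rotations
      cover {e} {v} v∈ v∈e with _∈?_ Fin._≟_ e es
      ... | yes e∈ = ∈-++⁺ˡ e∈
      ... | no  e∉ = ∈-++⁺ʳ es (∈-concatMap⁺ (offPath es) (lose v∈ (∈-offPath⁺ v∈e e∉)))

  -- Rotating one end keeps the other end and the path edges, so bad ends can be installed one after the other.
  good-rotations-or-bad-ends : ∀ {ℓ} {es} {Q : Pred (Fin n) ℓ} → Decidable Q → ∀ {u w} → LongestPath u w es →
    (∃₂ λ u′ w′ → Σ (LongestPath u′ w′ es) λ p → ∀ {v} → v ∈ rotations p → Q v) ⊎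
    (∃₂ λ u′ w′ → LongestPath u′ w′ es × ¬ Q u′ × ¬ Q w′)
  good-rotations-or-bad-ends Q? p with all? Q? (rotations p)
  ... | yes all = inj₁ (_ , _ , p , All.lookup all)
  ... | no ¬all with find (All.¬All⇒Any¬ Q? _ ¬all)
  -- After the reversal the bad end s is the fixed one, and rotations move the other end.
  ...   | s , s∈ , ¬Qs with all? Q? (rotations (reverse-path (rotate-to p s∈)))
  ...     | yes all  = inj₁ (_ , _ , reverse-path (rotate-to p s∈) , All.lookup all)
  ...     | no ¬all′ with find (All.¬All⇒Any¬ Q? _ ¬all′)
  ...       | t , t∈ , ¬Qt = inj₂ (t , s , rotate-to (reverse-path (rotate-to p s∈)) t∈ , ¬Qt , ¬Qs)

  generic-case : ¬ (q ≡ 2 × k ≡ 4) → ∀ {u w es} → LongestPath u w es → Goal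
  generic-case not-3-4 {es = es} p with good-rotations-or-bad-ends (λ v → length (nbrs es v) ≤? ⌊ k /2⌋) p
  ... | inj₂ (u′ , w′ , p′ , many , many′) with nbrs-sum p′
  ...   | inj₁ c   = cycle⇒goal c
  ...   | inj₂ sum = contradiction sum (<⇒≱ (begin-strict
    k                                           ≡⟨ ⌊n/2⌋+⌈n/2⌉≡n k ⟨
    -- Both counts are at least ⌊k/2⌋ + 1, which is strictly above ⌊k/2⌋ and not below ⌈k/2⌉.
    ⌊ k /2⌋ + ⌈ k /2⌉                           <⟨ +-mono-<-≤ (≰⇒> many) (≤-trans (⌊n/2⌋-mono (n≤1+n (suc k))) (≰⇒> many′)) ⟩
    length (nbrs es u′) + length (nbrs es w′)   ∎))
    where open ≤-Reasoning
  generic-case not-3-4 {es = es} p | inj₁ (u′ , w′ , p′ , few) with count-bound (length (rotations p′)) 2≤q r<k not-3-4 (1≤rotations p′)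
  ... | inj₁ bound = start-good p′ (≤-trans (*-monoʳ-≤ (suc q) (+-monoʳ-≤ (length (rotations p′))
          (few-offPath (start∈rotations p′)))) bound)
    where
    few-offPath : ∀ {v} → v ∈ rotations p′ → length (offPath es v) ≤ ⌊ k /2⌋ C q
    few-offPath {v} v∈ = ≤-trans (length-offPath es v) (C-monoˡ-≤ q (few v∈))
  ... | inj₂ bound = rotations-good p′ (⌊ k /2⌋ C q)
          (λ {v} v∈ → ≤-trans (length-offPath es v) (C-monoˡ-≤ q (few v∈))) bound

-- For r = 3 and k = 4 the counts just fail when both ends have off-path edges, and their position on the path matters.
module FourEdgePaths {n : ℕ} (H : Hypergraph n) (uniform : Uniform 3 H) (2≤q : 2 ≤ 2) (r<k : 3 < 4)
  (connected : Connected H) (longest : ∀ ℓ → BergePath H ℓ → ℓ ≤ 4) where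

  open Extremal {q = 2} {k = 4} H uniform 2≤q r<k connected longest
  open LongestPath

  -- A view: one match names all five vertices, four edges and eight incidences.
  data Four : ∀ {u w} → Walk H u w → Set where
    four : ∀ {v₀ v₁ v₂ v₃ v₄ e₁ e₂ e₃ e₄} v₀∈e₁ v₁∈e₁ v₁∈e₂ v₂∈e₂ v₂∈e₃ v₃∈e₃ v₃∈e₄ v₄∈e₄ →
      Four (step v₀ e₁ v₀∈e₁ v₁∈e₁ (step v₁ e₂ v₁∈e₂ v₂∈e₂ (step v₂ e₃ v₂∈e₃ v₃∈e₃ (step v₃ e₄ v₃∈e₄ v₄∈e₄ (stay v₄)))))

  four-edges : ∀ {u w} (x : Walk H u w) → length (edges x) ≡ 4 → Four x
  four-edges (step _ _ a b (step _ _ c d (step _ _ e f (step _ _ g h (stay _))))) refl = four a b c d e f g h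

  ¬edge-⊆-pair : ∀ f x y → ¬ (∀ {z} → z ∈ᴱ f → z ∈ x ∷ y ∷ [])
  ¬edge-⊆-pair f x y f⊆ = contradiction (∣p∣≤length {p = edge H f} (x ∷ y ∷ []) f⊆) (<⇒≱ (≤-reflexive (sym (uniform f))))

  -- The bound C(x, 2) on the number of off-path edges is positive only if x ≥ 2.
  2≤nbrs : ∀ {es v f} → v ∈ᴱ f → f ∉ es → 2 ≤ length (nbrs es v)
  2≤nbrs {es} {v} v∈ f∉ = lemma (≤-trans (length-⊆ {xs = _ ∷ []} ([] ∷ []) (λ { (here refl) → ∈-offPath⁺ {es} v∈ f∉ })) (length-offPath es v))
    where
    lemma : ∀ {x} → 1 ≤ x C 2 → 2 ≤ x
    lemma {suc (suc x)} _ = s≤s (s≤s z≤n)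

  -- The edge g gives w at least two of the at most four neighbours in `nbrs-sum`. This leaves two
  -- for u, and C(2, 2) = 1.
  offPath≤1 : ∀ {u w es f g} → LongestPath u w es → u ∈ᴱ f → f ∉ es → w ∈ᴱ g → g ∉ es → Goal ⊎ length (offPath es u) ≤ 1
  offPath≤1 {u} {w} {es} p u∈ f∉ w∈ g∉ with nbrs-sum p
  ... | inj₁ c   = inj₁ (cycle⇒goal c)
  ... | inj₂ sum = inj₂ (≤-trans (length-offPath es u) (C-monoˡ-≤ 2 (+-cancelʳ-≤ 2 (length (nbrs es u)) 2
        (≤-trans (+-monoʳ-≤ (length (nbrs es u)) (2≤nbrs {es} w∈ g∉)) sum))))

  -- If the first path edge is the only one at u, then u meets at most 2 = C(4, 2) / 3 edges, and S
  -- = {u} is good.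
  start-on-later-edge : ∀ {u w es} (p : LongestPath u w es) → length (offPath es u) ≤ 1 →
    Goal ⊎ (∃ λ s → s ∈ splits (walk p) × u ∈ᴱ mid s × tail s ≢ u)
  start-on-later-edge {u} p off≤1
    with any? (λ s → (u ∈ᴱ? mid s) ×-dec ¬? (tail s Fin.≟ u)) (splits (walk p))
  ... | yes found = inj₂ (find found)
  ... | no  none  = inj₁ (start-good p (*-monoʳ-≤ 3 (+-mono-≤ (length-⊆ {ys = u ∷ []} (rotations-unique p) only-u) off≤1)))
    where
    only-u : ∀ {x} → x ∈ rotations p → x ∈ u ∷ []
    only-u x∈ with ∈-map∘filter⁻ tail (λ s → u ∈ᴱ? mid s) {xs = splits (walk p)} x∈
    ... | s , s∈ , refl , u∈ with tail s Fin.≟ u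
    ...   | yes eq = here eq
    ...   | no  ≢u = contradiction (lose s∈ (u∈ , ≢u)) none

  -- Four-edge paths with an off-path edge at each end

  module _ {v₀ v₁ v₂ v₃ v₄ : Fin n} {e₁ e₂ e₃ e₄ : E} {es : List E}
    (v₀∈e₁ : v₀ ∈ᴱ e₁) (v₁∈e₁ : v₁ ∈ᴱ e₁) (v₁∈e₂ : v₁ ∈ᴱ e₂) (v₂∈e₂ : v₂ ∈ᴱ e₂)
    (v₂∈e₃ : v₂ ∈ᴱ e₃) (v₃∈e₃ : v₃ ∈ᴱ e₃) (v₃∈e₄ : v₃ ∈ᴱ e₄) (v₄∈e₄ : v₄ ∈ᴱ e₄) where

    private
      x : Walk H v₀ v₄
      x = step v₀ e₁ v₀∈e₁ v₁∈e₁ (step v₁ e₂ v₁∈e₂ v₂∈e₂ (step v₂ e₃ v₂∈e₃ v₃∈e₃ (step v₃ e₄ v₃∈e₄ v₄∈e₄ (stay v₄))))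

      s₂ s₃ s₄ : Split x
      s₂ = splitLater (split (stay v₁) e₂ v₁∈e₂ v₂∈e₂ _ refl)
      s₃ = splitLater (splitLater (split (stay v₂) e₃ v₂∈e₃ v₃∈e₃ _ refl))
      s₄ = splitLater (splitLater (splitLater (split (stay v₃) e₄ v₃∈e₄ v₄∈e₄ _ refl)))

    module _ (xv : Unique (verts x)) (xe : edges x ↭ es) (uniq : Unique es) (len : length es ≡ 4)
      {f g : E} (v₀∈f : v₀ ∈ᴱ f) (f∉ : f ∉ es) (v₄∈g : v₄ ∈ᴱ g) (g∉ : g ∉ es) where

      private
        p : LongestPath v₀ v₄ es
        p = longestPath x xv xe uniq len

      start-later : Goal ⊎ (v₀ ∈ᴱ e₂ ⊎ v₀ ∈ᴱ e₃ ⊎ v₀ ∈ᴱ e₄)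
      start-later with offPath≤1 p v₀∈f f∉ v₄∈g g∉
      ... | inj₁ goal = inj₁ goal
      ... | inj₂ off≤1 with start-on-later-edge p off≤1
      ...   | inj₁ goal = inj₁ goal
      ...   | inj₂ (_ , here refl , _ , ≢v₀) = contradiction refl ≢v₀
      ...   | inj₂ (_ , there (here refl) , v₀∈ , _) = inj₂ (inj₁ v₀∈)
      ...   | inj₂ (_ , there (there (here refl)) , v₀∈ , _) = inj₂ (inj₂ (inj₁ v₀∈))
      ...   | inj₂ (_ , there (there (there (here refl))) , v₀∈ , _) = inj₂ (inj₂ (inj₂ v₀∈))

      -- If v₀ lies on e₂ or e₄, a rotation makes v₁ or v₃ the start, and g closes a cycle. Only e₃
      -- is left as a later edge at v₀.
      start∈e₃ : v₁ ∈ᴱ g → v₃ ∈ᴱ g → Goal ⊎ v₀ ∈ᴱ e₃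
      start∈e₃ v₁∈g v₃∈g with start-later
      ... | inj₁ goal = inj₁ goal
      ... | inj₂ (inj₁ v₀∈e₂) = inj₁ (cycle⇒goal (cross-own p s₂ v₀∈e₂ g∉ v₄∈g v₁∈g))
      ... | inj₂ (inj₂ (inj₁ v₀∈e₃)) = inj₂ v₀∈e₃
      ... | inj₂ (inj₂ (inj₂ v₀∈e₄)) = inj₁ (cycle⇒goal (cross-own p s₄ v₀∈e₄ g∉ v₄∈g v₃∈g))

      -- If v₀ lies on e₃ or e₄, the rotated path starts at v₂ or v₃ and is closed by g. If v₀ lies
      -- on e₂, then e₂ contains v₀, v₁ and v₂, so it equals f by simplicity although f is off the
      -- path.
      adjacent-case : v₁ ∈ᴱ f → v₂ ∈ᴱ f → v₃ ∉ˢ edge H f → v₄ ∉ˢ edge H f → v₂ ∈ᴱ g → v₃ ∈ᴱ g → Goal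
      adjacent-case v₁∈f v₂∈f v₃∉f v₄∉f v₂∈g v₃∈g with start-later
      ... | inj₁ goal = goal
      ... | inj₂ (inj₂ (inj₁ v₀∈e₃)) = cycle⇒goal (cross-own p s₃ v₀∈e₃ g∉ v₄∈g v₂∈g)
      ... | inj₂ (inj₂ (inj₂ v₀∈e₄)) = cycle⇒goal (cross-own p s₄ v₀∈e₄ g∉ v₄∈g v₃∈g)
      ... | inj₂ (inj₁ v₀∈e₂) = contradiction (∈-resp-↭ xe (there (here f≡e₂))) f∉
        where
        f⊆e₂ : edge H f ⊆ˢ edge H e₂
        f⊆e₂ y∈ with start-edge-covered p v₀∈f f∉ y∈
        ... | here refl                                 = v₀∈e₂
        ... | there (here refl)                         = v₁∈e₂
        ... | there (there (here refl))                 = v₂∈e₂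
        ... | there (there (there (here refl)))         = contradiction y∈ v₃∉f
        ... | there (there (there (there (here refl)))) = contradiction y∈ v₄∉f
        f≡e₂ : f ≡ e₂
        f≡e₂ = simple H (⊆-∣∣-antisym f⊆e₂ (≤-reflexive (trans (uniform e₂) (sym (uniform f)))))

      -- The cycle is v₀ e₃ v₂ e₂ v₄ e₄ v₃ g v₁ f v₀.
      alternating-cycle : v₀ ∈ᴱ e₃ → v₄ ∈ᴱ e₂ → v₁ ∈ᴱ f → v₁ ∈ᴱ g → v₃ ∈ᴱ g → v₄ ∉ˢ edge H f → Cycle
      alternating-cycle v₀∈e₃ v₄∈e₂ v₁∈f v₁∈g v₃∈g v₄∉f = go xv (Unique-resp-↭ (↭-sym xe) uniq)
        where
        e₂∈ : e₂ ∈ es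
        e₂∈ = ∈-resp-↭ xe (there (here refl))
        e₃∈ : e₃ ∈ es
        e₃∈ = ∈-resp-↭ xe (there (there (here refl)))
        e₄∈ : e₄ ∈ es
        e₄∈ = ∈-resp-↭ xe (there (there (there (here refl))))
        ≢g : ∀ {e} → e ∈ es → e ≢ g
        ≢g e∈ refl = g∉ e∈
        f∉′ : f ∉ e₃ ∷ e₂ ∷ e₄ ∷ g ∷ []
        f∉′ (here refl)                         = f∉ e₃∈
        f∉′ (there (here refl))                 = f∉ e₂∈
        f∉′ (there (there (here refl)))         = f∉ e₄∈
        f∉′ (there (there (there (here refl)))) = v₄∉f v₄∈g
        go : Unique (verts x) → Unique (edges x) → Cycle
        go ((≢₀₁ ∷ ≢₀₂ ∷ ≢₀₃ ∷ ≢₀₄ ∷ []) ∷ (≢₁₂ ∷ ≢₁₃ ∷ ≢₁₄ ∷ []) ∷ (≢₂₃ ∷ ≢₂₄ ∷ []) ∷ (≢₃₄ ∷ []) ∷ [] ∷ [])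
           (_ ∷ (≢e₂₃ ∷ ≢e₂₄ ∷ []) ∷ (≢e₃₄ ∷ []) ∷ [] ∷ []) =
          cycle (longestPath
            (step v₀ e₃ v₀∈e₃ v₂∈e₃ (step v₂ e₂ v₂∈e₂ v₄∈e₂ (step v₄ e₄ v₄∈e₄ v₃∈e₄ (step v₃ g v₃∈g v₁∈g (stay v₁)))))
            ((≢₀₂ ∷ ≢₀₄ ∷ ≢₀₃ ∷ ≢₀₁ ∷ []) ∷ (≢₂₄ ∷ ≢₂₃ ∷ ≢-sym ≢₁₂ ∷ []) ∷ (≢-sym ≢₃₄ ∷ ≢-sym ≢₁₄ ∷ []) ∷ (≢-sym ≢₁₃ ∷ []) ∷ [] ∷ [])
            ↭-refl
            ((≢-sym ≢e₂₃ ∷ ≢e₃₄ ∷ ≢g e₃∈ ∷ []) ∷ (≢e₂₄ ∷ ≢g e₂∈ ∷ []) ∷ (≢g e₄∈ ∷ []) ∷ [] ∷ [])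
            refl)
          f f∉′ v₀∈f v₁∈f

    module _ (xv : Unique (verts x)) (xe : edges x ↭ es) (uniq : Unique es) (len : length es ≡ 4)
      {f g : E} (v₀∈f : v₀ ∈ᴱ f) (f∉ : f ∉ es) (v₄∈g : v₄ ∈ᴱ g) (g∉ : g ∉ es) where

      private
        p : LongestPath v₀ v₄ es
        p = longestPath x xv xe uniq len

        f-cover : ∀ {y} → y ∈ᴱ f → y ∈ v₀ ∷ v₁ ∷ v₂ ∷ v₃ ∷ v₄ ∷ []
        f-cover = start-edge-covered p v₀∈f f∉

        g-cover : ∀ {y} → y ∈ᴱ g → y ∈ v₄ ∷ v₃ ∷ v₂ ∷ v₁ ∷ v₀ ∷ []
        g-cover = start-edge-covered (reverse-path p) v₄∈g g∉

        -- Each inner vertex enters through an implication, so that an absent one can be discharged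
        -- by contradiction.
        pair-f : ∀ {a b} → (v₁ ∈ᴱ f → v₁ ∈ a ∷ b ∷ []) → (v₂ ∈ᴱ f → v₂ ∈ a ∷ b ∷ []) → (v₃ ∈ᴱ f → v₃ ∈ a ∷ b ∷ []) →
          v₀ ∈ a ∷ b ∷ [] → v₄ ∉ˢ edge H f → ∀ {y} → y ∈ᴱ f → y ∈ a ∷ b ∷ []
        pair-f h₁ h₂ h₃ h₀ v₄∉f y∈ with f-cover y∈
        ... | here refl                                 = h₀
        ... | there (here refl)                         = h₁ y∈
        ... | there (there (here refl))                 = h₂ y∈
        ... | there (there (there (here refl)))         = h₃ y∈
        ... | there (there (there (there (here refl)))) = contradiction y∈ v₄∉f

        pair-g : ∀ {a b} → (v₁ ∈ᴱ g → v₁ ∈ a ∷ b ∷ []) → (v₂ ∈ᴱ g → v₂ ∈ a ∷ b ∷ []) → (v₃ ∈ᴱ g → v₃ ∈ a ∷ b ∷ []) →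
          v₄ ∈ a ∷ b ∷ [] → v₀ ∉ˢ edge H g → ∀ {y} → y ∈ᴱ g → y ∈ a ∷ b ∷ []
        pair-g h₁ h₂ h₃ h₄ v₀∉g y∈ with g-cover y∈
        ... | here refl                                 = h₄
        ... | there (here refl)                         = h₃ y∈
        ... | there (there (here refl))                 = h₂ y∈
        ... | there (there (there (here refl)))         = h₁ y∈
        ... | there (there (there (there (here refl)))) = contradiction y∈ v₀∉g

      alternating-case : v₁ ∈ᴱ f → v₃ ∈ᴱ f → v₄ ∉ˢ edge H f → v₁ ∈ᴱ g → v₃ ∈ᴱ g → Goal ⊎ v₄ ∈ᴱ e₂ → Goal
      alternating-case v₁∈f v₃∈f v₄∉f v₁∈g v₃∈g (inj₁ goal) = goal
      alternating-case v₁∈f v₃∈f v₄∉f v₁∈g v₃∈g (inj₂ v₄∈e₂) with start∈e₃ xv xe uniq len v₀∈f f∉ v₄∈g g∉ v₁∈g v₃∈g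
      ... | inj₁ goal  = goal
      ... | inj₂ v₀∈e₃ = cycle⇒goal (alternating-cycle xv xe uniq len v₀∈f f∉ v₄∈g g∉ v₀∈e₃ v₄∈e₂ v₁∈f v₁∈g v₃∈g v₄∉f)

      -- Unless f or g contains both ends, each has at least two of v₁, v₂, v₃. If f has v₂ and g
      -- has v₁, or f has v₃ and g has v₂, then `cross` gives a cycle. Two patterns escape: v₀v₁v₂
      -- with v₂v₃v₄, and v₀v₁v₃ with v₁v₃v₄. The hypothesis `end∈e₂` is `start∈e₃` for the reversed
      -- path, supplied from outside because the vertices are fixed here.
      two-bad-ends : (v₁ ∈ᴱ f → v₃ ∈ᴱ f → v₁ ∈ᴱ g → v₃ ∈ᴱ g → Goal ⊎ v₄ ∈ᴱ e₂) → Goal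
      two-bad-ends end∈e₂ with v₄ ∈ᴱ? f | v₀ ∈ᴱ? g
      ... | yes v₄∈f | _        = cycle⇒goal (cycle p f f∉ v₀∈f v₄∈f)
      ... | no _     | yes v₀∈g = cycle⇒goal (cycle p g g∉ v₀∈g v₄∈g)
      ... | no v₄∉f  | no v₀∉g with v₁ ∈ᴱ? f | v₂ ∈ᴱ? f | v₃ ∈ᴱ? f | v₁ ∈ᴱ? g | v₂ ∈ᴱ? g | v₃ ∈ᴱ? g
      ... | _ | yes v₂∈f | _ | yes v₁∈g | _ | _ = cycle⇒goal (cross p s₂ f∉ v₀∈f v₂∈f g∉ v₄∈g v₁∈g)
      ... | _ | _ | yes v₃∈f | _ | yes v₂∈g | _ = cycle⇒goal (cross p s₃ f∉ v₀∈f v₃∈f g∉ v₄∈g v₂∈g)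
      ... | no v₁∉f | no v₂∉f | _ | _ | _ | _ =
        ⊥-elim (¬edge-⊆-pair f v₀ v₃ (pair-f (λ h → contradiction h v₁∉f) (λ h → contradiction h v₂∉f) (λ _ → there (here refl)) (here refl) v₄∉f))
      ... | no v₁∉f | _ | no v₃∉f | _ | _ | _ =
        ⊥-elim (¬edge-⊆-pair f v₀ v₂ (pair-f (λ h → contradiction h v₁∉f) (λ _ → there (here refl)) (λ h → contradiction h v₃∉f) (here refl) v₄∉f))
      ... | _ | no v₂∉f | no v₃∉f | _ | _ | _ =
        ⊥-elim (¬edge-⊆-pair f v₀ v₁ (pair-f (λ _ → there (here refl)) (λ h → contradiction h v₂∉f) (λ h → contradiction h v₃∉f) (here refl) v₄∉f))
      ... | _ | _ | _ | no v₁∉g | no v₂∉g | _ =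
        ⊥-elim (¬edge-⊆-pair g v₄ v₃ (pair-g (λ h → contradiction h v₁∉g) (λ h → contradiction h v₂∉g) (λ _ → there (here refl)) (here refl) v₀∉g))
      ... | _ | _ | _ | no v₁∉g | _ | no v₃∉g =
        ⊥-elim (¬edge-⊆-pair g v₄ v₂ (pair-g (λ h → contradiction h v₁∉g) (λ _ → there (here refl)) (λ h → contradiction h v₃∉g) (here refl) v₀∉g))
      ... | _ | _ | _ | _ | no v₂∉g | no v₃∉g =
        ⊥-elim (¬edge-⊆-pair g v₄ v₁ (pair-g (λ _ → there (here refl)) (λ h → contradiction h v₂∉g) (λ h → contradiction h v₃∉g) (here refl) v₀∉g))
      ... | yes v₁∈f | yes v₂∈f | no v₃∉f | no _ | yes v₂∈g | yes v₃∈g =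
        adjacent-case xv xe uniq len v₀∈f f∉ v₄∈g g∉ v₁∈f v₂∈f v₃∉f v₄∉f v₂∈g v₃∈g
      ... | yes v₁∈f | no _ | yes v₃∈f | yes v₁∈g | no _ | yes v₃∈g =
        alternating-case v₁∈f v₃∈f v₄∉f v₁∈g v₃∈g (end∈e₂ v₁∈f v₃∈f v₁∈g v₃∈g)

  off-path-at-both-ends : ∀ {u w es f g} → LongestPath u w es → u ∈ᴱ f → f ∉ es → w ∈ᴱ g → g ∉ es → Goal
  off-path-at-both-ends {es = es} p@(longestPath x xv xe uniq len) u∈f f∉ w∈g g∉ with four-edges x (edges-length p)
  ... | four a b c d e f g h =
    two-bad-ends a b c d e f g h xv xe uniq len u∈f f∉ w∈g g∉ λ v₁∈f v₃∈f v₁∈g v₃∈g →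
      let pᴿ = reverse-path p in
      start∈e₃ h g f e d c b a (verts-unique pᴿ) (edges-walk pᴿ) uniq len w∈g g∉ u∈f f∉ v₃∈f v₁∈f

  -- A bad end now is one with any off-path edge. If all a rotated ends are without, then for a = 1
  -- the vertex u meets a single edge, and for a ≥ 2 the ends meet only the 4 ≤ 2a path edges.
  exceptional-case : ∀ {u w es} → LongestPath u w es → Goal
  exceptional-case {es = es} p with good-rotations-or-bad-ends (λ v → length (offPath es v) ≤? 0) p
  ... | inj₂ (u′ , w′ , p′ , some , some′) =
    let f , f∈ = member (offPath es u′) some
        g , g∈ = member (offPath es w′) some′
        u∈f , f∉ = ∈-offPath⁻ {es} f∈
        w∈g , g∉ = ∈-offPath⁻ {es} g∈
    in off-path-at-both-ends p′ u∈f f∉ w∈g g∉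
    where
    member : ∀ (xs : List E) → ¬ length xs ≤ 0 → ∃ λ x → x ∈ xs
    member []       ≰0 = contradiction z≤n ≰0
    member (x ∷ xs) _  = x , here refl
  ... | inj₁ (u′ , w′ , p′ , none) with 2 ≤? length (rotations p′)
  ...   | no ≰  = start-good p′ (*-monoʳ-≤ 3 (≤-trans (+-mono-≤ (s≤s⁻¹ (≰⇒> ≰)) (none (start∈rotations p′))) (n≤1+n 1)))
  ...   | yes 2≤a = rotations-good p′ 0 none (begin
    3 * (4 + a * 0) ≡⟨ cong (λ z → 3 * (4 + z)) (*-zeroʳ a) ⟩
    6 * 2           ≤⟨ *-monoʳ-≤ 6 2≤a ⟩
    6 * a           ∎)
    where
    open ≤-Reasoning
    a = length (rotations p′)

theorem3p9 : ∀ (n r k : ℕ) (H : Hypergraph n) →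
    Uniform r H → Connected H → LongestPathLength H k →
    3 ≤ r → r < k →
    Σ (Subset n) λ S → GoodSet H r k S × ((∣ S ∣ < n) ⊎ (n ≡ k + 1))
theorem3p9 n (suc q) k H uniform connected (P , longest) (s≤s 2≤q) r<k
  with Extremal.longest-path H uniform 2≤q r<k connected longest P | q ≟ 2 ×-dec k ≟ 4
... | _ , _ , _ , p | yes (refl , refl) =
  let Extremal.goodSet S good size = FourEdgePaths.exceptional-case H uniform 2≤q r<k connected longest p in S , good , size
... | _ , _ , _ , p | no not-3-4 =
  let Extremal.goodSet S good size = Extremal.generic-case H uniform 2≤q r<k connected longest not-3-4 p in S , good , size
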